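{- The problem Saving Landmarks, parameterized by $k$, admits a kernel with at most $8k^4$ vertices: there is a polynomial-time algorithm that, given an instance $(G,k)$ of Saving Landmarks, outputs an equivalent instance $(G',k')$ of Saving Landmarks that constitutes a kernel and satisfies $|V(G')|\le 8k^4$.
   Context: Graphs are finite, simple and undirected. For a graph $G$, $\operatorname{d}_G(u,v)$ denotes the length of a shortest path between $u$ and $v$ in $G$ ($\infty$ if there is none). A set $W\subseteq V(G)$ is a resolving set of $G$ if for any two distinct $x,y\in V(G)$ there is $v\in W$ with $\operatorname{d}_G(v,x)\neq \operatorname{d}_G(v,y)$. Saving Landmarks: the input is a graph $G$ and a (non-negative) integer $k$, and the question is whether $G$ has a resolving set of size at most $n-k$, where $n=|V(G)|$. The parameter is $k$. A kernel of size $g(k)$ for a parameterized problem is a polynomial-time algorithm that takes an instance $(I,k)$ of the problem and outputs an instance $(I',k')$ of the same problem such that $(I,k)$ is a yes-instance if and only if $(I',k')$ is a yes-instance, and $|I'|+k'\le g(k)$. Two instances are equivalent if both are yes-instances or both are no-instances. -}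

module Defs where

open import Data.Bool using (Bool; true; false; T; if_then_else_)
open import Data.Fin using (Fin; fromℕ<; remQuot)
open import Data.Fin.Subset using (Subset; ∣_∣; _∈_)
open import Data.List using (List; []; _∷_)
open import Data.List.Relation.Unary.Unique.Propositional using (Unique)
open import Data.Maybe using (Maybe; just; nothing)
open import Data.Nat
  using (ℕ; suc; _+_; _*_; _∸_; _^_; _≤_; _<_; _≟_; _<?_)
open import Data.Product using (Σ; ∃-syntax; _×_; proj₁; uncurry)
open import Function using (_∘_; _⇔_)
open import Relation.Binary.Construct.Closure.ReflexiveTransitive
  using (Star; ε; _◅_)
open import Relation.Binary.PropositionalEquality using (_≡_; _≢_)
open import Relation.Nullary using (¬_; yes; no; does)

------------------------------------------------------------------------
-- Graphs and distances

-- A finite simple undirected graph with vertex set Fin n (n = 0 allowed).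
record Graph (n : ℕ) : Set where
  field
    adj         : Fin n → Fin n → Bool
    symmetric   : ∀ u v → adj u v ≡ adj v u
    irreflexive : ∀ u → adj u u ≡ false

  Adjacent : Fin n → Fin n → Set
  Adjacent u v = T (adj u v)

open Graph public

module _ {n : ℕ} (G : Graph n) where

  Walk : Fin n → Fin n → Set
  Walk = Star (Adjacent G)

  vertices : ∀ {u v} → Walk u v → List (Fin n)
  vertices {u} ε       = u ∷ []
  vertices {u} (_ ◅ w) = u ∷ vertices w

  walkLength : ∀ {u v} → Walk u v → ℕ
  walkLength ε       = 0
  walkLength (_ ◅ w) = suc (walkLength w)

  Path : Fin n → Fin n → Set
  Path u v = Σ (Walk u v) (Unique ∘ vertices)

  pathLength : ∀ {u v} → Path u v → ℕ
  pathLength = walkLength ∘ proj₁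

  -- The graph of the distance function, with values in ℕ ∪ {∞};
  -- nothing stands for ∞.
  data Distance (u v : Fin n) : Maybe ℕ → Set where
    finite   : (p : Path u v) → (∀ (q : Path u v) → pathLength p ≤ pathLength q) →
               Distance u v (just (pathLength p))
    infinite : ¬ Path u v → Distance u v nothing

  Resolves : Fin n → Fin n → Fin n → Set
  Resolves v x y =
    ∃[ d ] ∃[ e ] (Distance v x d × Distance v y e × d ≢ e)

  ResolvingSet : Subset n → Set
  ResolvingSet W = ∀ x y → x ≢ y → ∃[ v ] (v ∈ W × Resolves v x y)

------------------------------------------------------------------------
-- Parameterized graph problems

record Instance : Set where
  field
    order     : ℕ
    graph     : Graph order
    parameter : ℕ

open Instance public

Problem : Set₁
Problem = Instance → Set

-- ∣ W ∣ ≤ n - k is stated without subtraction: n - k may be negative.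
SavingLandmarks : Problem
SavingLandmarks I =
  ∃[ W ] (ResolvingSet (graph I) W × ∣ W ∣ + parameter I ≤ order I)

-- The size of the graph is that of its adjacency matrix, plus its order.
graphSize : Instance → ℕ
graphSize I = order I + order I * order I

instanceSize : Instance → ℕ
instanceSize I = graphSize I + parameter I

------------------------------------------------------------------------
-- Random access machines
--
-- Structured programs over a memory of registers and arrays of natural
-- numbers, both named by constants, so that a program uses finitely many
-- of each.  Every operation has unit cost.  As the only arithmetic is
-- addition and truncated subtraction, t steps increase the bit length of
-- the numbers in memory by O(t), and hence polynomial time agrees with
-- polynomial time on Turing machines.

data Expr : Set where
  const   : ℕ → Expr
  reg     : ℕ → Expr
  arr     : ℕ → Expr → Expr
  _⊕_ _⊖_ : Expr → Expr → Expr

data Program : Set where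
  skip          : Program
  _≔_           : ℕ → Expr → Program
  _[_]≔_        : ℕ → Expr → Expr → Program
  _⨾_           : Program → Program → Program
  If_Then_Else_ : Expr → Program → Program → Program
  While_Do_     : Expr → Program → Program

infixl 6 _⊕_ _⊖_
infix  5 _≔_ _[_]≔_
infix  4 If_Then_Else_ While_Do_
infixr 3 _⨾_

record Memory : Set where
  constructor memory
  field
    registers : ℕ → ℕ
    arrays    : ℕ → ℕ → ℕ

open Memory public

_[_↦_] : {A : Set} → (ℕ → A) → ℕ → A → (ℕ → A)
(f [ i ↦ a ]) j = if does (i ≟ j) then a else f j

⟦_⟧ : Expr → Memory → ℕ
⟦ const m ⟧ s = m
⟦ reg x   ⟧ s = registers s x
⟦ arr a e ⟧ s = arrays s a (⟦ e ⟧ s)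
⟦ e ⊕ f   ⟧ s = ⟦ e ⟧ s + ⟦ f ⟧ s
⟦ e ⊖ f   ⟧ s = ⟦ e ⟧ s ∸ ⟦ f ⟧ s

cost : Expr → ℕ
cost (const _) = 1
cost (reg _)   = 1
cost (arr _ e) = 1 + cost e
cost (e ⊕ f)   = 1 + cost e + cost f
cost (e ⊖ f)   = 1 + cost e + cost f

-- ⟨ p , s ⟩⇓[ t ] s′ : run from memory s, the program p halts after t
-- steps with memory s′.  A guard counts as true when it is non-zero.
data ⟨_,_⟩⇓[_]_ : Program → Memory → ℕ → Memory → Set where

  ⇓skip : ∀ {s} → ⟨ skip , s ⟩⇓[ 1 ] s

  ⇓assign : ∀ {s x e} →
    ⟨ x ≔ e , s ⟩⇓[ 1 + cost e ]
      memory (registers s [ x ↦ ⟦ e ⟧ s ]) (arrays s)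

  ⇓store : ∀ {s a e f} →
    ⟨ a [ e ]≔ f , s ⟩⇓[ 1 + cost e + cost f ]
      memory (registers s)
             (arrays s [ a ↦ arrays s a [ ⟦ e ⟧ s ↦ ⟦ f ⟧ s ] ])

  ⇓seq : ∀ {p q s s′ s″ t u} →
    ⟨ p , s ⟩⇓[ t ] s′ → ⟨ q , s′ ⟩⇓[ u ] s″ →
    ⟨ p ⨾ q , s ⟩⇓[ t + u ] s″

  ⇓then : ∀ {e p q s s′ t} → ⟦ e ⟧ s ≢ 0 →
    ⟨ p , s ⟩⇓[ t ] s′ →
    ⟨ If e Then p Else q , s ⟩⇓[ 1 + cost e + t ] s′

  ⇓else : ∀ {e p q s s′ t} → ⟦ e ⟧ s ≡ 0 →
    ⟨ q , s ⟩⇓[ t ] s′ →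
    ⟨ If e Then p Else q , s ⟩⇓[ 1 + cost e + t ] s′

  ⇓done : ∀ {e p s} → ⟦ e ⟧ s ≡ 0 →
    ⟨ While e Do p , s ⟩⇓[ 1 + cost e ] s

  ⇓loop : ∀ {e p s s′ s″ t u} → ⟦ e ⟧ s ≢ 0 →
    ⟨ p , s ⟩⇓[ t ] s′ → ⟨ While e Do p , s′ ⟩⇓[ u ] s″ →
    ⟨ While e Do p , s ⟩⇓[ 1 + cost e + t + u ] s″

------------------------------------------------------------------------
-- Polynomial-time algorithms on instances

-- The adjacency matrix as a 0/1 array in row-major order: the entry for
-- (i , j) is at n * i + j.  Cells beyond the matrix are 0.
matrix : ∀ {n} → Graph n → ℕ → ℕ
matrix {n} G c with c <? n * n
... | yes c<n² =
      if uncurry (adj G) (remQuot {n} n (fromℕ< c<n²)) then 1 else 0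
... | no  _    = 0

-- Register 0 holds the order, register 1 the parameter and array 0 the
-- adjacency matrix; the rest of the initial memory is 0.
input : Instance → Memory
input I = memory regs arrs
  where
  regs : ℕ → ℕ
  regs 0 = order I
  regs 1 = parameter I
  regs _ = 0

  arrs : ℕ → ℕ → ℕ
  arrs 0 = matrix (graph I)
  arrs _ = λ _ → 0

record Outputs (s : Memory) (I : Instance) : Set where
  field
    order-output     : registers s 0 ≡ order I
    parameter-output : registers s 1 ≡ parameter I
    graph-output     : ∀ c → c < order I * order I →
                       arrays s 0 c ≡ matrix (graph I) c

-- The size of the output is charged as well as the running time: a
-- register can hold a number exponential in the number of steps, whereas
-- the output consists of a whole matrix and a parameter in unary.
record PolynomialTime (f : Instance → Instance) : Set where
  field
    program            : Program
    coefficient degree : ℕ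
    run : ∀ I → ∃[ t ] ∃[ s ]
      ( ⟨ program , input I ⟩⇓[ t ] s
      × Outputs s (f I)
      × t + instanceSize (f I)
          ≤ coefficient * instanceSize I ^ degree + coefficient )

------------------------------------------------------------------------
-- Kernels

record IsKernel (P : Problem) (g : ℕ → ℕ) (f : Instance → Instance) : Set where
  field
    polynomialTime : PolynomialTime f
    equivalent     : ∀ I → P I ⇔ P (f I)
    bounded        : ∀ I → graphSize (f I) + parameter (f I) ≤ g (parameter I)

{-# OPTIONS --safe #-}

-- A set of vertices can be left out of a resolving set precisely when every two of its
-- members are resolved by a vertex outside of it, so (G , k) asks for k such vertices.
-- Twins, that is vertices with the same neighbours apart from themselves, are resolved by
-- themselves only, so all but one vertex of each twin class must be landmarks; keeping two
-- vertices of each class therefore changes neither the answer nor any distance.  Suppose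
-- at least 8k⁴ vertices are kept.  Call x and y near when fewer than k vertices see them
-- differently.  If greedily choosing pairwise far vertices reaches k of them, then each
-- pair is resolved from outside.  Otherwise some x₀ is near more than k(k + 1)² kept
-- vertices; among those one chooses k non-twins greedily so that none of them
-- distinguishes x₀ from another one.  Every vertex telling two of these apart then lies
-- outside the choice, and the answer is yes.
module Submission where

-- Two vertices per twin class are kept, not one, because vertices that separate must survive too.
-- Saved vertices are pairwise non-twins, so of two kept twins at most one stands for a saved
-- vertex, and the other is free to take over the role of a separating vertex. Exact distances
-- matter for this reduction only. When many vertices are kept, every separation comes from
-- adjacency: a vertex outside the choice that is adjacent to just one of x and y has distance 1 to
-- just one of them. Differences are counted in the whole graph while the choice is made among kept
-- vertices, so the large case answers the original instance directly. Inside a cluster each choice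
-- rules out at most k - 1 differences and one twin, and each of two greedy rounds costs a factor k
-- + 1. The count needed is k(1 + k(k + 1)²), which is at most 5k⁴ for k ≥ 1, so the constant 8 is
-- generous. The time bound needs an explicit program on a machine without multiplication or
-- comparisons. Twins and kept vertices are therefore described by sums and truncated differences,
-- in the very form in which the loops accumulate them.

open import Defs
open import Data.Bool using (Bool; T; T?; true; false; if_then_else_)
import Data.Bool.Properties as Bool
open import Data.Empty using (⊥; ⊥-elim)
open import Data.Fin as Fin using (Fin; toℕ; fromℕ<; combine; remQuot)
open import Data.Fin.Properties as Fin
  using (any?; all?; toℕ-injective; toℕ<n; toℕ-fromℕ<; toℕ-combine; remQuot-combine)
open import Data.Fin.Subset using (Subset; inside; outside; ∣_∣; ⊤; ∁; _-_) renaming (_∈_ to _∈ₛ_)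
open import Data.Fin.Subset.Properties
  using (∣⊤∣≡n; ∈⊤; x∈p⇒∣p-x∣<∣p∣; x∈p∧x≢y⇒x∈p-y; ∣∁p∣≡n∸∣p∣; x∈∁p⇒x∉p)
open import Data.List using (List; []; _∷_; _++_; length; filter; lookup; allFin; reverse; tabulate)
open import Data.List.Membership.Propositional using (_∈_; _∉_; find; lose)
open import Data.List.Membership.Propositional.Properties
  using (∈-filter⁻; ∈-filter⁺; ∈-allFin; ∈-lookup; ∈-++⁺ˡ; ∈-++⁺ʳ; ∈-tabulate⁻)
open import Data.List.Properties using (length-tabulate; length-++; length-reverse; unfold-reverse)
open import Data.List.Relation.Unary.All as All using (All; []; _∷_)
import Data.List.Relation.Unary.All.Properties as All
open import Data.List.Relation.Unary.AllPairs as AllPairs using (AllPairs; []; _∷_)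
import Data.List.Relation.Unary.AllPairs.Properties as AllPairs
open import Data.List.Relation.Unary.Any as Any using (here; there)
import Data.List.Relation.Unary.Any.Properties as Any
open import Data.List.Relation.Unary.Unique.Propositional using (Unique)
import Data.List.Relation.Unary.Unique.Propositional.Properties as Unique
open import Data.Maybe using (Maybe; just; nothing)
open import Data.Nat
  using (ℕ; zero; suc; _+_; _*_; _∸_; _^_; _⊓_; _≤_; _<_; z≤n; s≤s; s≤s⁻¹; z<s; _≡ᵇ_; _≟_;
         _≤?_; _<?_)
open import Data.Nat.Properties
open import Data.Nat.Solver using (module +-*-Solver)
open import Data.Product using (Σ; ∃-syntax; _×_; _,_; proj₁; proj₂; uncurry)
open import Data.Sum using (_⊎_; inj₁; inj₂)
open import Data.Unit using (tt)
open import Data.Vec using ([]; _∷_; here; there)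
open import Function using (flip; _∘_; id; _⇔_; mk⇔; module Equivalence)
open import Relation.Binary.Construct.Closure.ReflexiveTransitive using (ε; _◅_)
open import Relation.Binary.Definitions using (tri<; tri≈; tri>)
open import Relation.Binary.PropositionalEquality
open import Relation.Nullary using (¬_; ¬?; Dec; yes; no; contradiction; decidable-stable)
open import Relation.Nullary.Decidable using (map′; _×-dec_; _⊎-dec_; _→-dec_)
open import Relation.Unary using (Decidable)
open Equivalence using (to; from)

-- Lists without repetition and greedy choice

module _ {A : Set} where

  lookup-AllPairs : {R : A → A → Set} → (∀ {x y} → R x y → R y x) → ∀ {xs} → AllPairs R xs →
                    ∀ {i j} → i ≢ j → R (lookup xs i) (lookup xs j)
  lookup-AllPairs R-sym (r ∷ rs) {Fin.zero}  {Fin.zero}  i≢j = contradiction refl i≢j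
  lookup-AllPairs R-sym (r ∷ rs) {Fin.zero}  {Fin.suc j} i≢j = All.lookup r (∈-lookup j)
  lookup-AllPairs R-sym (r ∷ rs) {Fin.suc i} {Fin.zero}  i≢j = R-sym (All.lookup r (∈-lookup i))
  lookup-AllPairs R-sym (r ∷ rs) {Fin.suc i} {Fin.suc j} i≢j =
    lookup-AllPairs R-sym rs (i≢j ∘ cong Fin.suc)

  Unique-⊆⇒length≤ : ∀ {xs ys : List A} → Unique xs → (∀ {x} → x ∈ xs → x ∈ ys) →
                      length xs ≤ length ys
  Unique-⊆⇒length≤ {xs} {ys} xs! xs⊆ys = Fin.injective⇒≤ position-injective
    where
    position : Fin (length xs) → Fin (length ys)
    position i = Any.index (xs⊆ys (∈-lookup i))

    position-injective : ∀ {i j} → position i ≡ position j → i ≡ j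
    position-injective {i} {j} eq with i Fin.≟ j
    ... | yes i≡j = i≡j
    ... | no  i≢j = contradiction
      (trans (Any.lookup-index (xs⊆ys (∈-lookup i)))
        (trans (cong (lookup ys) eq) (sym (Any.lookup-index (xs⊆ys (∈-lookup j))))))
      (lookup-AllPairs ≢-sym xs! i≢j)

  length-filter-¬ : {P : A → Set} (P? : Decidable P) → ∀ xs →
                    length xs ≡ length (filter P? xs) + length (filter (¬? ∘ P?) xs)
  length-filter-¬ P? [] = refl
  length-filter-¬ P? (x ∷ xs) with P? x
  ... | yes _ = cong suc (length-filter-¬ P? xs)
  ... | no  _ = trans (cong suc (length-filter-¬ P? xs)) (sym (+-suc _ _))

  AllPairs-∈ : {R : A → A → Set} → ∀ {xs} → AllPairs R xs →
               AllPairs (λ x y → x ∈ xs × y ∈ xs × R x y) xs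
  AllPairs-∈ []       = []
  AllPairs-∈ (r ∷ rs) =
    All.tabulate (λ y∈xs → here refl , there y∈xs , All.lookup r y∈xs) ∷
    AllPairs.map (λ (x∈ , y∈ , Rxy) → there x∈ , there y∈ , Rxy) (AllPairs-∈ rs)

  AllPairs-reverse : {R : A → A → Set} → ∀ {xs} → AllPairs R xs → AllPairs (flip R) (reverse xs)
  AllPairs-reverse {xs = []} [] = []
  AllPairs-reverse {xs = x ∷ xs} (r ∷ rs) = subst (AllPairs _) (sym (unfold-reverse x xs))
    (AllPairs.++⁺ (AllPairs-reverse rs) ([] ∷ [])
      (All.tabulate (λ y∈ → All.lookup r (Any.reverse⁻ y∈) ∷ [])))

module _ {n : ℕ} where

  open import Data.List.Membership.DecPropositional (Fin._≟_ {n}) using (_∈?_)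

  private
    V = Fin n

  Unique⇒length≤n : {xs : List V} → Unique xs → length xs ≤ n
  Unique⇒length≤n {xs} xs! =
    subst (length xs ≤_) (length-tabulate {n = n} id) (Unique-⊆⇒length≤ xs! (λ {x} _ → ∈-allFin x))

  avoid : List V → List V → List V
  avoid F = filter (¬? ∘ (_∈? F))

  length-avoid : ∀ {xs} F → Unique xs → length xs ≤ length F + length (avoid F xs)
  length-avoid {xs} F xs! = begin
    length xs                                                ≡⟨ length-filter-¬ (_∈? F) xs ⟩
    length (filter (_∈? F) xs) + length (avoid F xs)
      ≤⟨ +-monoˡ-≤ _ (Unique-⊆⇒length≤ (Unique.filter⁺ (_∈? F) xs!)
           (λ x∈ → proj₂ (∈-filter⁻ (_∈? F) {xs = xs} x∈))) ⟩
    length F + length (avoid F xs)                           ∎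
    where open ≤-Reasoning

  -- Each choice uses up itself and at most `d` entries of `F x`, whence the factor `suc d`. Only
  -- later choices are kept out of `F` of earlier ones; carrying an arbitrary `R` along lets a
  -- second round preserve what a first one achieved.
  greedy : (F : V → List V) {R : V → V → Set} → (∀ {x y} → R x y → x ≢ y) →
           ∀ d N xs → AllPairs R xs → (∀ {x} → x ∈ xs → length (F x) ≤ d) →
           N * suc d ≤ length xs →
           ∃[ ys ] (length ys ≡ N × (∀ {y} → y ∈ ys → y ∈ xs) ×
                    AllPairs (λ x y → R x y × y ∉ F x) ys)
  greedy F R⇒≢ d zero    xs       _        _   _  = [] , refl , (λ ()) , []
  greedy F R⇒≢ d (suc N) []       _        _   ()
  greedy F {R} R⇒≢ d (suc N) (x ∷ xs) (r ∷ rs) F≤d (s≤s big) = extend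
    (greedy F R⇒≢ d N rest (AllPairs.filter⁺ outside? rs) (F≤d ∘ there ∘ proj₁ ∘ split) enough)
    where
    outside? : Decidable (λ y → y ∉ F x)
    outside? = ¬? ∘ (_∈? F x)

    rest : List V
    rest = avoid (F x) xs

    split : ∀ {y} → y ∈ rest → y ∈ xs × y ∉ F x
    split = ∈-filter⁻ outside?

    enough : N * suc d ≤ length rest
    enough = +-cancelˡ-≤ d _ _ (≤-trans big (≤-trans (length-avoid (F x) (AllPairs.map R⇒≢ rs))
      (+-monoˡ-≤ _ (F≤d (here refl)))))

    extend : (∃[ ys ] (length ys ≡ N × (∀ {y} → y ∈ ys → y ∈ rest) ×
                       AllPairs (λ x y → R x y × y ∉ F x) ys)) →
             ∃[ ys ] (length ys ≡ suc N × (∀ {y} → y ∈ ys → y ∈ x ∷ xs) ×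
                      AllPairs (λ x y → R x y × y ∉ F x) ys)
    extend (ys , refl , ys⊆ , pairs) =
      x ∷ ys , refl
      , (λ { (here eq) → here eq ; (there y∈) → there (proj₁ (split (ys⊆ y∈))) })
      , All.tabulate (λ y∈ → let y∈xs , y∉F = split (ys⊆ y∈) in All.lookup r y∈xs , y∉F) ∷ pairs

-- Distances through walks of bounded length

least : {P : ℕ → Set} → (∀ l → Dec (P l)) → ∀ n →
        (∃[ l ] (P l × (∀ {j} → P j → l ≤ j))) ⊎ (∀ {j} → j < n → ¬ P j)
least P? zero = inj₂ λ ()
least {P} P? (suc n) with least P? n
... | inj₁ found = inj₁ found
... | inj₂ none with P? n
...   | yes Pn = inj₁ (n , Pn , λ Pj → ≮⇒≥ (λ j<n → none j<n Pj))
...   | no ¬Pn = inj₂ none′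
  where
  none′ : ∀ {j} → j < suc n → ¬ P j
  none′ (s≤s j≤n) Pj with m≤n⇒m<n∨m≡n j≤n
  ... | inj₁ j<n  = none j<n Pj
  ... | inj₂ refl = ¬Pn Pj

module _ {n : ℕ} (G : Graph n) where

  -- Walks of bounded length replace shortest paths: the relation is decidable by recursion on `l`,
  -- needs no case for ∞, and is preserved by maps that contract edges.
  Within : ℕ → Fin n → Fin n → Set
  Within l u v = Σ (Walk G u v) λ w → walkLength G w ≤ l

  Same : Fin n → Fin n → Fin n → Fin n → Set
  Same u v u′ v′ = ∀ l → Within l u v ⇔ Within l u′ v′

module _ {n : ℕ} {G : Graph n} where

  Adjacent-sym : ∀ {u v} → Adjacent G u v → Adjacent G v u
  Adjacent-sym {u} {v} = subst T (symmetric G u v)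

  Adjacent⇒≢ : ∀ {u v} → Adjacent G u v → u ≢ v
  Adjacent⇒≢ {u} e refl = subst T (irreflexive G u) e

  Within-mono : ∀ {l m u v} → l ≤ m → Within G l u v → Within G m u v
  Within-mono l≤m (w , w≤l) = w , ≤-trans w≤l l≤m

  Within-step : ∀ {l u v w} → Adjacent G u v → Within G l v w → Within G (suc l) u w
  Within-step e (w , w≤l) = e ◅ w , s≤s w≤l

  Within-unstep : ∀ {l u w} → Within G (suc l) u w →
                  u ≡ w ⊎ ∃[ v ] (Adjacent G u v × Within G l v w)
  Within-unstep (ε , _) = inj₁ refl
  Within-unstep (e ◅ w , s≤s w≤l) = inj₂ (_ , e , w , w≤l)

  Within? : ∀ l u v → Dec (Within G l u v)
  Within? zero u v = map′ (λ { refl → ε , z≤n }) (λ { (ε , _) → refl }) (u Fin.≟ v)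
  Within? (suc l) u w = map′
    (λ { (inj₁ refl) → ε , z≤n ; (inj₂ (v , e , within)) → Within-step e within })
    Within-unstep
    (u Fin.≟ w ⊎-dec any? (λ v → T? (adj G u v) ×-dec Within? l v w))

  Within-sym : ∀ {l u v} → Within G l u v → Within G l v u
  Within-sym (w , w≤l) = reverseOnto w ε (≤-trans (≤-reflexive (+-identityʳ _)) w≤l)
    where
    reverseOnto : ∀ {l u v x} (w : Walk G u v) (acc : Walk G u x) →
                  walkLength G w + walkLength G acc ≤ l → Within G l v x
    reverseOnto ε acc bound = acc , bound
    reverseOnto (e ◅ w) acc bound =
      reverseOnto w (Adjacent-sym e ◅ acc) (≤-trans (≤-reflexive (+-suc (walkLength G w) _)) bound)

  suffix : ∀ {u v x} (w : Walk G u v) → Unique (vertices G w) → x ∈ vertices G w →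
           Σ (Path G x v) λ p → pathLength G p ≤ walkLength G w
  suffix ε       w! (here refl) = (ε , w!) , z≤n
  suffix (e ◅ w) w! (here refl) = (e ◅ w , w!) , ≤-refl
  suffix (e ◅ w) (_ ∷ w!) (there x∈) with p , p≤w ← suffix w w! x∈ = p , m≤n⇒m≤1+n p≤w

  -- If the first vertex recurs in the shortened remainder, the loop is cut by starting at that
  -- recurrence.
  shorten : ∀ {u v} (w : Walk G u v) → Σ (Path G u v) λ p → pathLength G p ≤ walkLength G w
  shorten ε = (ε , [] ∷ []) , z≤n
  shorten {u} (e ◅ w) with shorten w
  ... | (p , p!) , p≤w with u ∈? vertices G p
    where open import Data.List.Membership.DecPropositional (Fin._≟_ {n}) using (_∈?_)
  ...   | no  u∉p = (e ◅ p , All.¬Any⇒All¬ _ u∉p ∷ p!) , s≤s p≤w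
  ...   | yes u∈p with q , q≤p ← suffix p p! u∈p = q , m≤n⇒m≤1+n (≤-trans q≤p p≤w)

  length-vertices : ∀ {u v} (w : Walk G u v) → length (vertices G w) ≡ suc (walkLength G w)
  length-vertices ε       = refl
  length-vertices (e ◅ w) = cong suc (length-vertices w)

  pathLength<n : ∀ {u v} (p : Path G u v) → pathLength G p < n
  pathLength<n (w , w!) = subst (_≤ n) (length-vertices w) (Unique⇒length≤n w!)

  -- A path has fewer than `n` edges, so a search for lengths below `n` that fails proves the
  -- distance infinite.
  distance : ∀ u v → ∃[ d ] Distance G u v d
  distance u v with least (λ l → Within? l u v) n
  ... | inj₂ none = nothing , infinite λ p → none (pathLength<n p) (proj₁ p , ≤-refl)
  ... | inj₁ (l , (w , w≤l) , minimal) with p , p≤w ← shorten w =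
    _ , finite p λ q → ≤-trans (≤-trans p≤w w≤l) (minimal (proj₁ q , ≤-refl))

  Distance-unique : ∀ {u v u′ v′ d e} → Distance G u v d → Distance G u′ v′ e →
                    Same G u v u′ v′ → d ≡ e
  Distance-unique (finite (w , w!) w-min) (finite (x , x!) x-min) same
    with y , y≤w ← to (same _) (w , ≤-refl) | z , z≤x ← from (same _) (x , ≤-refl)
    with p , p≤y ← shorten y | q , q≤z ← shorten z =
    cong just (≤-antisym (≤-trans (w-min q) (≤-trans q≤z z≤x))
                         (≤-trans (x-min p) (≤-trans p≤y y≤w)))
  Distance-unique (finite (w , _) _) (infinite none) same =
    ⊥-elim (none (proj₁ (shorten (proj₁ (to (same _) (w , ≤-refl))))))
  Distance-unique (infinite none) (finite (w , _) _) same =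
    ⊥-elim (none (proj₁ (shorten (proj₁ (from (same _) (w , ≤-refl))))))
  Distance-unique (infinite _) (infinite _) same = refl

  data AtMost (l : ℕ) : Maybe ℕ → Set where
    at-most : ∀ {d} → d ≤ l → AtMost l (just d)

  Distance⇒Within⇔ : ∀ {u v d} → Distance G u v d → ∀ {l} → Within G l u v ⇔ AtMost l d
  Distance⇒Within⇔ (finite (w , _) minimal) = mk⇔
    (λ (x , x≤l) → let p , p≤x = shorten x in at-most (≤-trans (minimal p) (≤-trans p≤x x≤l)))
    (λ { (at-most w≤l) → w , w≤l })
  Distance⇒Within⇔ (infinite none) = mk⇔ (λ (x , _) → ⊥-elim (none (proj₁ (shorten x)))) λ ()

  Distance⇒Same : ∀ {u v u′ v′ d} → Distance G u v d → Distance G u′ v′ d → Same G u v u′ v′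
  Distance⇒Same D D′ l = mk⇔ (from (Distance⇒Within⇔ D′) ∘ to (Distance⇒Within⇔ D))
                             (from (Distance⇒Within⇔ D) ∘ to (Distance⇒Within⇔ D′))

  Resolves⇔¬Same : ∀ {v x y} → Resolves G v x y ⇔ (¬ Same G v x v y)
  Resolves⇔¬Same {v} {x} {y} = mk⇔
    (λ (d , e , D , E , d≢e) same → d≢e (Distance-unique D E same))
    (λ ¬same → let d , D = distance v x ; e , E = distance v y in
       d , e , D , E , λ d≡e → ¬same (Distance⇒Same D (subst (Distance G v y) (sym d≡e) E)))

  Same-refl : ∀ {u v} → Same G u v u v
  Same-refl l = mk⇔ id id

  Same-sym : ∀ {u v u′ v′} → Same G u v u′ v′ → Same G u′ v′ u v
  Same-sym s l = mk⇔ (from (s l)) (to (s l))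

  Same-trans : ∀ {u v u′ v′ u″ v″} → Same G u v u′ v′ → Same G u′ v′ u″ v″ → Same G u v u″ v″
  Same-trans s s′ l = mk⇔ (to (s′ l) ∘ to (s l)) (from (s l) ∘ from (s′ l))

  Same-swap : ∀ {u v} → Same G u v v u
  Same-swap l = mk⇔ Within-sym Within-sym

-- Saved vertices and twins

enumerate : ∀ {n} (p : Subset n) k → k ≤ ∣ p ∣ →
            Σ (Fin k → Fin n) λ s → (∀ {i j} → s i ≡ s j → i ≡ j) × (∀ i → s i ∈ₛ p)
enumerate p zero _ = (λ ()) , (λ {}) , λ ()
enumerate (outside ∷ p) (suc k) k≤ with s , inj , s∈ ← enumerate p (suc k) k≤ =
  Fin.suc ∘ s , inj ∘ Fin.suc-injective , there ∘ s∈
enumerate {suc n} (inside ∷ p) (suc k) (s≤s k≤) with s , inj , s∈ ← enumerate p k k≤ =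
  s⁺ , s⁺-injective , s⁺∈
  where
  s⁺ : Fin (suc k) → Fin (suc n)
  s⁺ Fin.zero    = Fin.zero
  s⁺ (Fin.suc i) = Fin.suc (s i)

  s⁺-injective : ∀ {i j} → s⁺ i ≡ s⁺ j → i ≡ j
  s⁺-injective {Fin.zero}  {Fin.zero}  _  = refl
  s⁺-injective {Fin.suc i} {Fin.suc j} eq = cong Fin.suc (inj (Fin.suc-injective eq))

  s⁺∈ : ∀ i → s⁺ i ∈ₛ inside ∷ p
  s⁺∈ Fin.zero    = here
  s⁺∈ (Fin.suc i) = there (s∈ i)

complement : ∀ {n} k (s : Fin k → Fin n) → (∀ {i j} → s i ≡ s j → i ≡ j) →
             ∃[ W ] (∣ W ∣ + k ≤ n × (∀ {v} → (∀ l → v ≢ s l) → v ∈ₛ W))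
complement {n} zero s _ =
  ⊤ , ≤-reflexive (trans (+-identityʳ _) (∣⊤∣≡n n)) , λ _ → ∈⊤
complement (suc k) s inj
  with W , small , W∋ ← complement k (s ∘ Fin.suc) (Fin.suc-injective ∘ inj) =
  W - s Fin.zero
  , ≤-trans (≤-reflexive (+-suc _ k)) (≤-trans (+-monoˡ-≤ k (x∈p⇒∣p-x∣<∣p∣ s₀∈W)) small)
  , λ v∉s → x∈p∧x≢y⇒x∈p-y (W∋ (v∉s ∘ Fin.suc)) (v∉s Fin.zero)
  where
  s₀∈W : s Fin.zero ∈ₛ W
  s₀∈W = W∋ λ l eq → contradiction (inj eq) λ ()

-- The vertices s i are the ones a resolving set may leave out.
Saved : ∀ {n} → Graph n → ℕ → Set
Saved {n} G k = Σ (Fin k → Fin n) λ s → ∀ {i j} → i ≢ j →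
  ∃[ v ] ((∀ l → v ≢ s l) × ¬ Same G v (s i) v (s j))

-- A pair with a member in `W` is resolved by that member, the only vertex at distance 0 from
-- itself; hence only pairs of left-out vertices matter. Injectivity of `s` comes for free, since
-- nothing separates a vertex from itself.
SavingLandmarks⇔Saved : ∀ I → SavingLandmarks I ⇔ Saved (graph I) (parameter I)
SavingLandmarks⇔Saved record { order = n ; graph = G ; parameter = k } = mk⇔ ⇒ ⇐
  where
  ⇒ : SavingLandmarks _ → Saved G k
  ⇒ (W , resolving , small)
    with s , inj , s∈ ← enumerate (∁ W) k
           (subst (k ≤_) (sym (∣∁p∣≡n∸∣p∣ W)) (m+n≤o⇒m≤o∸n k (subst (_≤ n) (+-comm ∣ W ∣ k) small))) =
    s , λ {i} {j} i≢j → let v , v∈W , resolves = resolving (s i) (s j) (i≢j ∘ inj) in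
      v , (λ l eq → x∈∁p⇒x∉p (s∈ l) (subst (_∈ₛ W) eq v∈W)) , to Resolves⇔¬Same resolves

  ⇐ : Saved G k → SavingLandmarks _
  ⇐ (s , separated) with complement k s inj
    where
    inj : ∀ {i j} → s i ≡ s j → i ≡ j
    inj {i} {j} eq with i Fin.≟ j
    ... | yes i≡j = i≡j
    ... | no  i≢j with v , _ , ¬same ← separated i≢j =
      contradiction (subst (λ x → Same G v (s i) v x) eq Same-refl) ¬same
  ... | W , small , W∋ = W , resolving , small
    where
    itself : ∀ {x y} → x ≢ y → ¬ Same G x x x y
    itself x≢y same with to (same 0) (ε , z≤n)
    ... | ε , _ = x≢y refl

    resolving : ResolvingSet G W
    resolving x y x≢y
      with any? (λ i → s i Fin.≟ x) | any? (λ i → s i Fin.≟ y)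
    ... | no x∉s | _ = x , W∋ (λ l eq → x∉s (l , sym eq)) , from Resolves⇔¬Same (itself x≢y)
    ... | yes _ | no y∉s = y , W∋ (λ l eq → y∉s (l , sym eq))
      , from Resolves⇔¬Same (itself (≢-sym x≢y) ∘ Same-sym)
    ... | yes (i , refl) | yes (j , refl) with v , v∉s , ¬same ← separated (x≢y ∘ cong s) =
      v , W∋ v∉s , from Resolves⇔¬Same ¬same

module _ {n : ℕ} (G : Graph n) where

  Twin : Fin n → Fin n → Set
  Twin u v = ∀ w → w ≢ u → w ≢ v → adj G u w ≡ adj G v w

  Twin? : ∀ u v → Dec (Twin u v)
  Twin? u v = all? λ w → ¬? (w Fin.≟ u) →-dec (¬? (w Fin.≟ v) →-dec (adj G u w Bool.≟ adj G v w))

module _ {n : ℕ} (G : Graph n) where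

  Twin-refl : ∀ {u} → Twin G u u
  Twin-refl w _ _ = refl

  Twin-sym : ∀ {u v} → Twin G u v → Twin G v u
  Twin-sym t w w≢v w≢u = sym (t w w≢u w≢v)

  Twin-trans : ∀ {u v w} → Twin G u v → Twin G v w → Twin G u w
  Twin-trans {u} {v} {w} t t′ z z≢u z≢w with z Fin.≟ v | w Fin.≟ u | w Fin.≟ v | u Fin.≟ v
  ... | no z≢v | _ | _ | _ = trans (t z z≢u z≢v) (t′ z z≢v z≢w)
  ... | yes _ | yes refl | _ | _ = refl
  ... | yes _ | _ | yes refl | _ = t z z≢u z≢w
  ... | yes _ | _ | _ | yes refl = t′ z z≢u z≢w
  -- The middle vertex is the one place where the hypotheses do not simply compose. The pairs uv, uw
  -- and vw are all edges or all non-edges: a twin class is a clique or independent.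
  ... | yes refl | no w≢u | no w≢v | no u≢v = begin
    adj G u v  ≡⟨ symmetric G u v ⟩
    adj G v u  ≡⟨ t′ u u≢v (≢-sym w≢u) ⟩
    adj G w u  ≡⟨ symmetric G w u ⟩
    adj G u w  ≡⟨ t w w≢u w≢v ⟩
    adj G v w  ≡⟨ symmetric G v w ⟩
    adj G w v  ∎
    where open ≡-Reasoning

  -- Only the first step changes: `v` has the same neighbour to go to, unless that neighbour is `v`
  -- itself and the step is dropped. The empty walk has to be excluded.
  Twin-Within : ∀ {u v x l} → Twin G u v → x ≢ u → Within G l u x → Within G l v x
  Twin-Within t x≢u (ε , _) = contradiction refl x≢u
  Twin-Within {u} {v} t x≢u (_◅_ {j = w} e p , s≤s p≤l) with w Fin.≟ v
  ... | yes refl = p , m≤n⇒m≤1+n p≤l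
  ... | no  w≢v  = subst T (t w (≢-sym (Adjacent⇒≢ {G = G} e)) w≢v) e ◅ p , s≤s p≤l

  Twin⇒Sameˡ : ∀ {u u′ v} → Twin G u u′ → v ≢ u → v ≢ u′ → Same G u v u′ v
  Twin⇒Sameˡ t v≢u v≢u′ l = mk⇔ (Twin-Within t v≢u) (Twin-Within (Twin-sym t) v≢u′)

  Twin⇒Sameʳ : ∀ {u v v′} → Twin G v v′ → u ≢ v → u ≢ v′ → Same G u v u v′
  Twin⇒Sameʳ t u≢v u≢v′ =
    Same-trans {G = G} Same-swap (Same-trans {G = G} (Twin⇒Sameˡ t u≢v u≢v′) Same-swap)

  -- The ends are replaced one after the other, in an order that keeps the intermediate pair
  -- distinct. If neither order does, the pair has merely been swapped.
  Twin⇒Same : ∀ {u v u′ v′} → Twin G u u′ → Twin G v v′ → u ≢ v → u′ ≢ v′ → Same G u v u′ v′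
  Twin⇒Same {u} {v} {u′} {v′} t t′ u≢v u′≢v′ with u′ Fin.≟ v | v′ Fin.≟ u
  ... | no u′≢v  | _        = Same-trans {G = G} (Twin⇒Sameˡ t (≢-sym u≢v) (≢-sym u′≢v))
                                         (Twin⇒Sameʳ t′ u′≢v u′≢v′)
  ... | yes refl | yes refl = Same-swap
  ... | yes refl | no v′≢u  = Same-trans {G = G} (Twin⇒Sameʳ t′ u≢v (≢-sym v′≢u))
                                         (Twin⇒Sameˡ t v′≢u (≢-sym u′≢v′))

-- Deleting vertices that retain two twins

record IsReduction {n m} (G : Graph n) (H : Graph m) (K : Fin m → Fin n) : Set where
  field
    injective : ∀ {a b} → K a ≡ K b → a ≡ b
    induced   : ∀ a b → adj H a b ≡ adj G (K a) (K b)
    two-twins : ∀ v → (∀ a → K a ≢ v) →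
                ∃[ a ] ∃[ b ] (a ≢ b × Twin G (K a) v × Twin G (K b) v)

module _ {n m} {G : Graph n} {H : Graph m} {K : Fin m → Fin n} (red : IsReduction G H K) where

  open IsReduction red

  retract : ∀ v → ∃[ a ] (Twin G v (K a) × (∀ b → K b ≡ v → b ≡ a))
  retract v with any? (λ a → K a Fin.≟ v)
  ... | yes (a , refl) = a , Twin-refl G , λ b → injective
  ... | no none with a , _ , _ , t , _ ← two-twins v (λ a eq → none (a , eq)) =
    a , Twin-sym G t , λ b eq → contradiction (b , eq) none

  ρ : Fin n → Fin m
  ρ v = proj₁ (retract v)

  ρ-twin : ∀ v → Twin G v (K (ρ v))
  ρ-twin v = proj₁ (proj₂ (retract v))

  ρ-fixed : ∀ a → ρ (K a) ≡ a
  ρ-fixed a = sym (proj₂ (proj₂ (retract (K a))) a refl)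

  -- First `u` and then `v` is replaced by its kept twin. The first replacement fails only if `v` is
  -- that twin of `u`, and then both ends have the same image.
  ρ-edge : ∀ {u v} → Adjacent G u v → ρ u ≡ ρ v ⊎ Adjacent H (ρ u) (ρ v)
  ρ-edge {u} {v} e with ρ u Fin.≟ ρ v | v Fin.≟ K (ρ u)
  ... | yes eq | _ = inj₁ eq
  ... | no _ | yes eq = inj₁ (trans (sym (ρ-fixed (ρ u))) (cong ρ (sym eq)))
  ... | no ρu≢ρv | no v≢ρu = inj₂ (subst T (sym (induced _ _)) (Adjacent-sym {G = G} e″))
    where
    e′ : Adjacent G (K (ρ u)) v
    e′ = subst T (ρ-twin u v (≢-sym (Adjacent⇒≢ {G = G} e)) v≢ρu) e

    e″ : Adjacent G (K (ρ v)) (K (ρ u))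
    e″ = subst T (ρ-twin v (K (ρ u)) (≢-sym v≢ρu) (ρu≢ρv ∘ injective)) (Adjacent-sym {G = G} e′)

  Within-ρ : ∀ {l u v} → Within G l u v → Within H l (ρ u) (ρ v)
  Within-ρ (ε , l≤) = ε , l≤
  Within-ρ {u = u} {v} (e ◅ w , s≤s w≤l) with ρ-edge e
  ... | inj₁ eq = Within-mono (n≤1+n _) (subst (λ a → Within H _ a (ρ v)) (sym eq) (Within-ρ (w , w≤l)))
  ... | inj₂ e′ = Within-step e′ (Within-ρ (w , w≤l))

  Within-K : ∀ {l a b} → Within H l a b → Within G l (K a) (K b)
  Within-K (ε , l≤) = ε , l≤
  Within-K (e ◅ w , s≤s w≤l) = Within-step (subst T (induced _ _) e) (Within-K (w , w≤l))

  -- Neither `ρ` nor `K` lengthens walks, and `ρ` undoes `K`.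
  isometric : ∀ {l a b} → Within G l (K a) (K b) ⇔ Within H l a b
  isometric {l} {a} {b} = mk⇔ (subst₂ (Within H l) (ρ-fixed a) (ρ-fixed b) ∘ Within-ρ) Within-K

  Same-K : ∀ {a b c d} → Same G (K a) (K b) (K c) (K d) ⇔ Same H a b c d
  Same-K = mk⇔
    (λ same l → mk⇔ (to isometric ∘ to (same l) ∘ from isometric)
                    (to isometric ∘ from (same l) ∘ from isometric))
    (λ same l → mk⇔ (from isometric ∘ to (same l) ∘ to isometric)
                    (from isometric ∘ from (same l) ∘ to isometric))

  Saved-extend : ∀ {k} → Saved H k → Saved G k
  Saved-extend (s , separated) = K ∘ s , λ i≢j →
    let v , v∉s , ¬same = separated i≢j in
    K v , (λ l → v∉s l ∘ injective) , ¬same ∘ to Same-K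

  -- Moving saved and separating vertices to kept twins changes no distance as long as the two stay
  -- distinct. So the separating vertex must avoid the images of all saved vertices, which is where
  -- the second kept twin is used.
  Saved-restrict : ∀ {k} → Saved G k → Saved H k
  Saved-restrict {k} (s , separated) = ρ ∘ s , separated′
    where
    no-twins : ∀ {i j} → Twin G (s i) (s j) → i ≡ j
    no-twins {i} {j} t with i Fin.≟ j
    ... | yes i≡j = i≡j
    ... | no  i≢j with v , v∉s , ¬same ← separated i≢j =
      contradiction (Twin⇒Sameʳ G t (v∉s i) (v∉s j)) ¬same

    Free : Fin m → Set
    Free a = ∀ l → a ≢ ρ (s l)

    free-twin : ∀ v → (∀ a → K a ≢ v) → ∃[ a ] (Twin G v (K a) × Free a)
    free-twin v v∉K with two-twins v v∉K
    ... | a , b , a≢b , a~v , b~v with any? (λ l → a Fin.≟ ρ (s l))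
    ...   | no  a-free = a , Twin-sym G a~v , λ l eq → a-free (l , eq)
    -- Were `b` occupied too, by `s l′`, then `s l` and `s l′` would be twins through `v`, forcing
    -- `l ≡ l′` and so `a ≡ b`.
    ...   | yes (l , refl) = b , Twin-sym G b~v , λ { l′ refl → a≢b (cong (ρ ∘ s) (no-twins
            (Twin-trans G (ρ-twin (s l)) (Twin-trans G a~v
              (Twin-trans G (Twin-sym G b~v) (Twin-sym G (ρ-twin (s l′)))))))) }

    free : ∀ v → (∀ l → v ≢ s l) → ∃[ a ] (Twin G v (K a) × Free a)
    free v v∉s with any? (λ a → K a Fin.≟ v)
    ... | no v∉K = free-twin v λ a eq → v∉K (a , eq)
    ... | yes (a , refl) with any? (λ l → a Fin.≟ ρ (s l))
    ...   | no  a-free = a , Twin-refl G , λ l eq → a-free (l , eq)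
    -- Here `v` is kept but is the image of some `s l` other than itself. Hence `s l` was dropped
    -- and has two kept twins, one of them free.
    ...   | yes (l , refl) with b , t , b-free ← free-twin (s l)
              (λ c eq → v∉s l (trans (cong (K ∘ ρ) (sym eq)) (trans (cong K (ρ-fixed c)) eq))) =
      b , Twin-trans G (Twin-sym G (ρ-twin (s l))) t , b-free

    separated′ : ∀ {i j} → i ≢ j →
                 ∃[ a ] (Free a × ¬ Same H a (ρ (s i)) a (ρ (s j)))
    separated′ {i} {j} i≢j with v , v∉s , ¬same ← separated i≢j with a , t , a-free ← free v v∉s =
      a , a-free , λ same → ¬same
        (Same-trans {G = G} (moved i) (Same-trans {G = G} (from Same-K same) (Same-sym {G = G} (moved j))))
      where
      moved : ∀ l → Same G v (s l) (K a) (K (ρ (s l)))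
      moved l = Twin⇒Same G t (ρ-twin (s l)) (v∉s l) (a-free l ∘ injective)

-- Many vertices without three mutual twins

length≤1 : {A : Set} {xs : List A} → Unique xs → (∀ {x y} → x ∈ xs → y ∈ xs → x ≡ y) →
           length xs ≤ 1
length≤1 {xs = []}          _ _ = z≤n
length≤1 {xs = _ ∷ []}      _ _ = s≤s z≤n
length≤1 {xs = _ ∷ _ ∷ _} ((x≢y ∷ _) ∷ _) eq =
  contradiction (eq (here refl) (there (here refl))) x≢y

module _ {n : ℕ} (G : Graph n) where

  open import Data.List.Membership.DecPropositional (Fin._≟_ {n}) using (_∈?_)

  neighbour⇒¬Same : ∀ {x y z} → z ≢ y → Adjacent G x z → ¬ Adjacent G y z → ¬ Same G z x z y
  neighbour⇒¬Same z≢y x~z y≁z same with to (same 1) (Adjacent-sym {G = G} x~z ◅ ε , s≤s z≤n)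
  ... | ε           , _      = z≢y refl
  ... | (e ◅ ε)     , _      = y≁z (Adjacent-sym {G = G} e)
  ... | (_ ◅ _ ◅ _) , s≤s ()

  -- `z` has distance 1 to exactly one of the two. The counting below works with adjacency alone by
  -- virtue of this.
  differ⇒¬Same : ∀ {x y z} → z ≢ x → z ≢ y → adj G x z ≢ adj G y z → ¬ Same G z x z y
  differ⇒¬Same {x} {y} {z} z≢x z≢y x≢y with adj G x z in ex | adj G y z in ey
  ... | false | false = contradiction refl x≢y
  ... | true  | true  = contradiction refl x≢y
  ... | true  | false = neighbour⇒¬Same z≢y (subst T (sym ex) tt) (subst T ey)
  ... | false | true  = neighbour⇒¬Same z≢x (subst T (sym ey) tt) (subst T ex) ∘ Same-sym {G = G}

  -- Deliberately asymmetric: `y` is left out, whereas `x` is listed when adjacent to `y`. Thus `y`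
  -- can be counted on top of the differences, which saves one in the threshold for being far.
  differences : Fin n → Fin n → List (Fin n)
  differences x y = filter (λ z → ¬? (z Fin.≟ y) ×-dec ¬? (adj G x z Bool.≟ adj G y z)) (allFin n)

  ∈-differences⁺ : ∀ {x y z} → z ≢ y → adj G x z ≢ adj G y z → z ∈ differences x y
  ∈-differences⁺ {x} {y} z≢y x≢y =
    ∈-filter⁺ (λ z → ¬? (z Fin.≟ y) ×-dec ¬? (adj G x z Bool.≟ adj G y z)) (∈-allFin _) (z≢y , x≢y)

  ∈-differences⁻ : ∀ {x y z} → z ∈ differences x y → z ≢ y × adj G x z ≢ adj G y z
  ∈-differences⁻ {x} {y} z∈ = proj₂ (∈-filter⁻
    (λ z → ¬? (z Fin.≟ y) ×-dec ¬? (adj G x z Bool.≟ adj G y z)) {xs = allFin n} z∈)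

  differences-Unique : ∀ x y → Unique (differences x y)
  differences-Unique x y = Unique.filter⁺ _ (Unique.allFin⁺ n)

  ¬Twin⇒differ : ∀ {x y} → ¬ Twin G x y → ∃[ z ] (z ≢ x × z ≢ y × adj G x z ≢ adj G y z)
  ¬Twin⇒differ {x} {y} ¬twin
    with any? (λ z → ¬? (z Fin.≟ x) ×-dec ¬? (z Fin.≟ y) ×-dec ¬? (adj G x z Bool.≟ adj G y z))
  ... | yes found = found
  ... | no  none  = contradiction
    (λ z z≢x z≢y → decidable-stable (_ Bool.≟ _) (λ x≢y → none (z , z≢x , z≢y , x≢y))) ¬twin

  Separated : List (Fin n) → Fin n → Fin n → Set
  Separated xs x y = ∃[ z ] (z ∉ xs × adj G x z ≢ adj G y z)

  Separated⇒Saved : ∀ {xs} →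
    (∀ {i j} → i ≢ j → Separated xs (lookup xs i) (lookup xs j)) → Saved G (length xs)
  Separated⇒Saved {xs} separated = lookup xs , λ {i} {j} i≢j →
    let z , z∉xs , x≢y = separated i≢j
        z≢ = λ l eq → z∉xs (subst (_∈ xs) (sym eq) (∈-lookup l))
    in z , z≢ , differ⇒¬Same (z≢ i) (z≢ j) x≢y

  -- Together with `y` the differences are more than `length xs` distinct vertices. One of them lies
  -- outside `xs`, and it is not `y`.
  far⇒Separated : ∀ {x y xs} → y ∈ xs → length xs ≤ length (differences x y) → Separated xs x y
  far⇒Separated {x} {y} {xs} y∈xs long with Any.any? (λ z → ¬? (z ∈? xs)) (differences x y)
  ... | yes found = let z , z∈ , z∉xs = find found in z , z∉xs , proj₂ (∈-differences⁻ z∈)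
  ... | no  none = contradiction (Unique-⊆⇒length≤ y∷D! y∷D⊆xs) (<⇒≱ (s≤s long))
    where
    y∷D! : Unique (y ∷ differences x y)
    y∷D! = All.tabulate (λ z∈ → ≢-sym (proj₁ (∈-differences⁻ z∈))) ∷ differences-Unique x y

    y∷D⊆xs : ∀ {z} → z ∈ y ∷ differences x y → z ∈ xs
    y∷D⊆xs (here refl) = y∈xs
    y∷D⊆xs {z} (there z∈) = decidable-stable (z ∈? xs) λ z∉xs → none (lose z∈ z∉xs)

  -- Relative to a base point x₀, any difference between x and y is a difference of one
  -- of them from x₀; so it lies outside xs as soon as xs avoids all differences from x₀.
  near⇒Separated : ∀ x₀ {xs x y} → x ∈ xs → y ∈ xs → ¬ Twin G x y →
    (∀ {u v} → u ∈ xs → v ∈ xs → u ≢ v → v ∉ differences x₀ u) → Separated xs x y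
  near⇒Separated x₀ {xs} {x} {y} x∈ y∈ ¬twin avoids
    with z , z≢x , z≢y , x≢y ← ¬Twin⇒differ ¬twin = z , z∉xs , x≢y
    where
    z∉xs : z ∉ xs
    z∉xs z∈ with adj G x₀ z Bool.≟ adj G x z
    ... | no  x₀≢x = avoids x∈ z∈ (≢-sym z≢x) (∈-differences⁺ z≢x x₀≢x)
    ... | yes x₀≡x = avoids y∈ z∈ (≢-sym z≢y) (∈-differences⁺ z≢y (x≢y ∘ trans (sym x₀≡x)))

  module _ {L : List (Fin n)} (L! : Unique L)
    (thin : ∀ {x y z} → x ∈ L → y ∈ L → z ∈ L → x ≢ y → x ≢ z → y ≢ z →
            Twin G x y → Twin G x z → ⊥) where

    siblings : Fin n → List (Fin n)
    siblings x = filter (λ y → ¬? (y Fin.≟ x) ×-dec Twin? G x y) L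

    ∈-siblings⁻ : ∀ {x y} → y ∈ siblings x → y ∈ L × y ≢ x × Twin G x y
    ∈-siblings⁻ {x} = ∈-filter⁻ (λ y → ¬? (y Fin.≟ x) ×-dec Twin? G x y)

    ∈-siblings⁺ : ∀ {x y} → y ∈ L → y ≢ x → Twin G x y → y ∈ siblings x
    ∈-siblings⁺ {x} y∈ y≢x t = ∈-filter⁺ (λ y → ¬? (y Fin.≟ x) ×-dec Twin? G x y) y∈ (y≢x , t)

    length-siblings : ∀ {x} → x ∈ L → length (siblings x) ≤ 1
    length-siblings {x} x∈ = length≤1 (Unique.filter⁺ _ L!) equal
      where
      equal : ∀ {y z} → y ∈ siblings x → z ∈ siblings x → y ≡ z
      equal {y} {z} y∈ z∈ with ∈-siblings⁻ y∈ | ∈-siblings⁻ z∈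
      ... | y∈L , y≢x , x~y | z∈L , z≢x , x~z = decidable-stable (y Fin.≟ z) λ y≢z →
        thin x∈ y∈L z∈L (≢-sym y≢x) (≢-sym z≢x) y≢z x~y x~z

    Near : ℕ → Fin n → Fin n → Set
    Near k x y = length (differences x y) < k

    near? : ∀ k x → Decidable (Near k x)
    near? k x y = length (differences x y) <? k

    cluster : ℕ → Fin n → List (Fin n)
    cluster k x = filter (near? k x) L

    module _ (k : ℕ) (x₀ : Fin n) where

      -- What must not be chosen along with `x`: a vertex on which `x` and `x₀` disagree, or the
      -- twin of `x` in `L`.
      obstacles : Fin n → List (Fin n)
      obstacles x = differences x₀ x ++ siblings x

      length-obstacles : ∀ {x} → x ∈ cluster k x₀ → length (obstacles x) ≤ k
      length-obstacles {x} x∈ with x∈L , near ← ∈-filter⁻ (near? k x₀) {xs = L} x∈ = begin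
        length (obstacles x)                             ≡⟨ length-++ (differences x₀ x) ⟩
        length (differences x₀ x) + length (siblings x)  ≤⟨ +-monoʳ-≤ _ (length-siblings x∈L) ⟩
        length (differences x₀ x) + 1                    ≡⟨ +-comm _ 1 ⟩
        suc (length (differences x₀ x))                  ≤⟨ near ⟩
        k                                                ∎
        where open ≤-Reasoning

      Unobstructed : Fin n → Fin n → Set
      Unobstructed x y = (y ≢ x × x ∉ obstacles y) × y ∉ obstacles x

      Unobstructed-sym : ∀ {x y} → Unobstructed x y → Unobstructed y x
      Unobstructed-sym ((y≢x , x∉) , y∉) = (≢-sym y≢x , y∉) , x∉

      -- The first greedy choice rules out y ∈ obstacles x for x before y; the second one,
      -- made on the reversed list, rules it out for x after y.
      unobstructed : k * suc k * suc k ≤ length (cluster k x₀) →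
                     ∃[ zs ] (length zs ≡ k × (∀ {z} → z ∈ zs → z ∈ L) × AllPairs Unobstructed zs)
      unobstructed big
        with ys , ys-length , ys⊆ , ys-pairs ←
               greedy obstacles {_≢_} id k (k * suc k) (cluster k x₀)
                 (Unique.filter⁺ (near? k x₀) L!) length-obstacles big
        with zs , zs-length , zs⊆ , zs-pairs ←
               greedy obstacles {λ x y → y ≢ x × x ∉ obstacles y} (≢-sym ∘ proj₁) k k (reverse ys)
                 (AllPairs-reverse ys-pairs) (length-obstacles ∘ ys⊆ ∘ Any.reverse⁻)
                 (≤-reflexive (sym (trans (length-reverse ys) ys-length))) =
        zs , zs-length
        , proj₁ ∘ ∈-filter⁻ (near? k x₀) {xs = L} ∘ ys⊆ ∘ Any.reverse⁻ ∘ zs⊆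
        , zs-pairs

      cluster⇒Saved : k * suc k * suc k ≤ length (cluster k x₀) → Saved G k
      cluster⇒Saved big with zs , zs-length , zs⊆L , pairs ← unobstructed big =
        subst (Saved G) zs-length (Separated⇒Saved λ {i} {j} i≢j →
          near⇒Separated x₀ (∈-lookup i) (∈-lookup j) (not-twins (∈-lookup j) (apart i≢j)) avoids)
        where
        apart : ∀ {i j} → i ≢ j → Unobstructed (lookup zs i) (lookup zs j)
        apart = lookup-AllPairs Unobstructed-sym pairs

        not-twins : ∀ {x y} → y ∈ zs → Unobstructed x y → ¬ Twin G x y
        not-twins y∈ ((y≢x , _) , y∉) twin =
          y∉ (∈-++⁺ʳ (differences x₀ _) (∈-siblings⁺ (zs⊆L y∈) y≢x twin))

        avoids : ∀ {u v} → u ∈ zs → v ∈ zs → u ≢ v → v ∉ differences x₀ u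
        avoids u∈ v∈ u≢v v∈D = proj₂ unobstructed-uv (∈-++⁺ˡ v∈D)
          where
          u-index = Any.lookup-index u∈
          v-index = Any.lookup-index v∈
          unobstructed-uv = subst₂ Unobstructed (sym u-index) (sym v-index)
            (apart λ eq → u≢v (trans u-index (trans (cong (lookup zs) eq) (sym v-index))))

    sparse⇒Saved : ∀ k d → (∀ x → length (cluster k x) ≤ d) → k * suc d ≤ length L → Saved G k
    sparse⇒Saved k d sparse big
      with zs , refl , zs⊆ , pairs ←
             greedy (cluster k) {_≢_} id d k L L! (λ _ → sparse _) big =
      Separated⇒Saved (lookup-AllPairs flip-Separated (AllPairs.map separate (AllPairs-∈ pairs)))
      where
      flip-Separated : ∀ {x y} → Separated zs x y → Separated zs y x
      flip-Separated (z , z∉ , x≢y) = z , z∉ , ≢-sym x≢y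

      separate : ∀ {x y} → x ∈ zs × y ∈ zs × x ≢ y × y ∉ cluster k x → Separated zs x y
      separate (_ , y∈ , _ , y∉) =
        far⇒Separated y∈ (≮⇒≥ λ near → y∉ (∈-filter⁺ (near? k _) (zs⊆ y∈) near))

    -- The cases split at cluster size k(k + 1)²: of so many vertices a first greedy round leaves
    -- k(k + 1) and a second one k. If no cluster is larger, each greedy choice of far vertices
    -- discards at most that many.
    large⇒Saved : ∀ k → 8 * k ^ 4 ≤ length L → Saved G k
    large⇒Saved zero    _   = (λ ()) , λ {}
    large⇒Saved (suc j) big with any? (λ x → suc j * suc (suc j) * suc (suc j) <? length (cluster (suc j) x))
    ... | yes (x₀ , clustered) = cluster⇒Saved (suc j) x₀ (<⇒≤ clustered)
    ... | no  sparse = sparse⇒Saved (suc j) (suc j * suc (suc j) * suc (suc j))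
            (λ x → ≮⇒≥ λ clustered → sparse (x , clustered)) (≤-trans slack big)
      where
      open +-*-Solver
      -- 8k⁴ − k(1 + k(k + 1)²) has non-negative coefficients in j = k − 1.
      slack : suc j * suc (suc j * suc (suc j) * suc (suc j)) ≤ 8 * suc j ^ 4
      slack = ≤-trans (m≤m+n _ (3 + 19 * j + 35 * j ^ 2 + 26 * j ^ 3 + 7 * j ^ 4))
        (≤-reflexive (solve 1
          (λ j → let k = con 1 :+ j ; k⁺ = con 2 :+ j in
            k :* (con 1 :+ k :* k⁺ :* k⁺) :+
            (con 3 :+ con 19 :* j :+ con 35 :* j :^ 2 :+ con 26 :* j :^ 3 :+ con 7 :* j :^ 4)
            := con 8 :* k :^ 4)
          refl j))

-- The kernel

-- The last term is added on the right, as by a loop counting upwards, so the accumulator's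
-- invariant advances by computation.
sumTo : (ℕ → ℕ) → ℕ → ℕ
sumTo f zero    = 0
sumTo f (suc n) = sumTo f n + f n

sumTo-mono : ∀ f {m n} → m ≤ n → sumTo f m ≤ sumTo f n
sumTo-mono f {n = zero} z≤n = z≤n
sumTo-mono f {m} {suc n} m≤1+n with m≤n⇒m<n∨m≡n m≤1+n
... | inj₁ (s≤s m≤n) = ≤-trans (sumTo-mono f m≤n) (m≤m+n _ _)
... | inj₂ refl      = ≤-refl

sumTo-≤ : ∀ {f} → (∀ i → f i ≤ 1) → ∀ n → sumTo f n ≤ n
sumTo-≤ f≤1 zero    = z≤n
sumTo-≤ f≤1 (suc n) = ≤-trans (+-mono-≤ (sumTo-≤ f≤1 n) (f≤1 n)) (≤-reflexive (+-comm n 1))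

term≤sumTo : ∀ f {i n} → i < n → f i ≤ sumTo f n
term≤sumTo f i<n = ≤-trans (m≤n+m _ _) (sumTo-mono f i<n)

two-terms≤sumTo : ∀ f {i j n} → i < j → j < n → f i + f j ≤ sumTo f n
two-terms≤sumTo f {j = j} i<j j<n =
  ≤-trans (+-monoˡ-≤ (f j) (term≤sumTo f i<j)) (sumTo-mono f j<n)

sumTo≡0 : ∀ f n → (∀ {i} → i < n → f i ≡ 0) → sumTo f n ≡ 0
sumTo≡0 f zero    _   = refl
sumTo≡0 f (suc n) f≡0 = cong₂ _+_ (sumTo≡0 f n (f≡0 ∘ m≤n⇒m≤1+n)) (f≡0 ≤-refl)

positive-term : ∀ f n → 0 < sumTo f n → ∃[ i ] (i < n × 0 < f i)
positive-term f (suc n) pos with f n in eq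
... | suc _ = n , ≤-refl , subst (0 <_) (sym eq) z<s
... | zero with i , i<n , fi ← positive-term f n (subst (0 <_) (+-identityʳ _) pos) =
  i , m≤n⇒m≤1+n i<n , fi

two-positive-terms : ∀ {f} → (∀ i → f i ≤ 1) → ∀ n → 1 < sumTo f n →
                     ∃[ i ] ∃[ j ] (i < j × j < n × 0 < f i × 0 < f j)
two-positive-terms {f} f≤1 (suc n) big with f n in eq | f≤1 n
... | zero | _ with i , j , i<j , j<n , fi , fj ←
                    two-positive-terms f≤1 n (subst (1 <_) (+-identityʳ _) big) =
  i , j , i<j , m≤n⇒m≤1+n j<n , fi , fj
... | suc zero | _ with i , i<n , fi ← positive-term f n (s≤s⁻¹ (subst (1 <_) (+-comm _ 1) big)) =
  i , n , i<n , ≤-refl , fi , subst (0 <_) (sym eq) z<s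
... | suc (suc _) | s≤s ()

-- Prefix sums of a 0/1 sequence rise in steps of one, so each value below the total is attained
-- just before some 1.
select : ∀ {f} → (∀ i → f i ≤ 1) → ∀ n {a} → a < sumTo f n →
         ∃[ i ] (i < n × f i ≡ 1 × sumTo f i ≡ a)
select {f} f≤1 (suc n) {a} a< with a <? sumTo f n
... | yes a<′ with i , i<n , fi , eq ← select f≤1 n a<′ = i , m≤n⇒m≤1+n i<n , fi , eq
... | no  a≮ with f n in eq | f≤1 n
...   | zero        | _      = contradiction (subst (a <_) (+-identityʳ _) a<) a≮
...   | suc zero    | _      =
  n , ≤-refl , eq , ≤-antisym (≮⇒≥ a≮) (s≤s⁻¹ (subst (a <_) (+-comm _ 1) a<))
...   | suc (suc _) | s≤s ()

sumTo-<-term : ∀ {f i j} → f i ≡ 1 → i < j → sumTo f i < sumTo f j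
sumTo-<-term {f} {i} fi i<j = ≤-trans
  (≤-reflexive (trans (+-comm 1 _) (cong (sumTo f i +_) (sym fi)))) (sumTo-mono f i<j)

sumTo-injective : ∀ {f i j} → f i ≡ 1 → f j ≡ 1 → sumTo f i ≡ sumTo f j → i ≡ j
sumTo-injective {i = i} {j} fi fj eq with <-cmp i j
... | tri< i<j _ _ = contradiction eq (<⇒≢ (sumTo-<-term fi i<j))
... | tri≈ _ i≡j _ = i≡j
... | tri> _ _ j<i = contradiction (sym eq) (<⇒≢ (sumTo-<-term fj j<i))

-- Twins in the arithmetic of the machine

gap : ℕ → ℕ → ℕ
gap a b = (a ∸ b) + (b ∸ a)

-- The minimum, written with the arithmetic of the machine.
meet : ℕ → ℕ → ℕ
meet a b = a ∸ (a ∸ b)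

meet≡⊓ : ∀ a b → meet a b ≡ a ⊓ b
meet≡⊓ a b with ≤-total a b
... | inj₁ a≤b = trans (cong (a ∸_) (m≤n⇒m∸n≡0 a≤b)) (sym (m≤n⇒m⊓n≡m a≤b))
... | inj₂ b≤a = trans (m∸[m∸n]≡n b≤a) (sym (m≥n⇒m⊓n≡n b≤a))

≡⇒gap : ∀ {a b} → a ≡ b → gap a b ≡ 0
≡⇒gap {a} refl = cong₂ _+_ (n∸n≡0 a) (n∸n≡0 a)

gap≡0 : ∀ {a b} → gap a b ≡ 0 → a ≡ b
gap≡0 {a} {b} eq = ≤-antisym (m∸n≡0⇒m≤n (m+n≡0⇒m≡0 (a ∸ b) eq))
                             (m∸n≡0⇒m≤n (m+n≡0⇒n≡0 (a ∸ b) eq))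

meet≡0 : ∀ a b → meet a b ≡ 0 → a ≡ 0 ⊎ b ≡ 0
meet≡0 zero    b       _  = inj₁ refl
meet≡0 (suc a) zero    _  = inj₂ refl
meet≡0 (suc a) (suc b) eq with () ← trans (sym (meet≡⊓ (suc a) (suc b))) eq

meet-zeroˡ : ∀ {a} b → a ≡ 0 → meet a b ≡ 0
meet-zeroˡ b refl = 0∸n≡0 (0 ∸ b)

meet-zeroʳ : ∀ a {b} → b ≡ 0 → meet a b ≡ 0
meet-zeroʳ a refl = n∸n≡0 a

module Twins (n : ℕ) (A : ℕ → ℕ) where

  -- Non-zero means true: `gap` expresses inequality and `meet` conjunction. The value is non-zero
  -- when `w` witnesses that `u` and `v` are not twins.
  mismatch : ℕ → ℕ → ℕ → ℕ
  mismatch u v w = meet (meet (gap w u) (gap w v)) (gap (A (n * u + w)) (A (n * v + w)))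

  mismatches : ℕ → ℕ → ℕ
  mismatches u v = sumTo (mismatch u v) n

  -- Counts the twins of `v` that precede it. `flag` admits at most one, so each class keeps its
  -- first two members.
  earlier : ℕ → ℕ
  earlier v = sumTo (λ u → 1 ∸ mismatches u v) v

  -- Opaque because case splits would otherwise normalise flag to nested sums.
  opaque

    flag : ℕ → ℕ
    flag v = 1 ∸ (earlier v ∸ 1)

    flag-def : ∀ v → flag v ≡ 1 ∸ (earlier v ∸ 1)
    flag-def v = refl

  -- For a kept vertex this is its index in the kernel.
  rank : ℕ → ℕ
  rank = sumTo flag

  flag≤1 : ∀ v → flag v ≤ 1
  flag≤1 v = ≤-trans (≤-reflexive (flag-def v)) (m∸n≤m 1 (earlier v ∸ 1))

  mismatch≡0⁻ : ∀ u v w → mismatch u v w ≡ 0 → w ≡ u ⊎ w ≡ v ⊎ A (n * u + w) ≡ A (n * v + w)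
  mismatch≡0⁻ u v w eq with meet≡0 (meet (gap w u) (gap w v)) _ eq
  ... | inj₂ eq′ = inj₂ (inj₂ (gap≡0 eq′))
  ... | inj₁ eq′ with meet≡0 (gap w u) _ eq′
  ...   | inj₁ eq″ = inj₁ (gap≡0 eq″)
  ...   | inj₂ eq″ = inj₂ (inj₁ (gap≡0 eq″))

  mismatch≡0⁺ : ∀ u v w → w ≡ u ⊎ w ≡ v ⊎ A (n * u + w) ≡ A (n * v + w) → mismatch u v w ≡ 0
  mismatch≡0⁺ u v w (inj₁ w≡u) = meet-zeroˡ (gap (A (n * u + w)) (A (n * v + w))) (meet-zeroˡ (gap w v) (≡⇒gap w≡u))
  mismatch≡0⁺ u v w (inj₂ (inj₁ w≡v)) = meet-zeroˡ (gap (A (n * u + w)) (A (n * v + w))) (meet-zeroʳ (gap w u) (≡⇒gap w≡v))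
  mismatch≡0⁺ u v w (inj₂ (inj₂ eq)) = meet-zeroʳ (meet (gap w u) (gap w v)) (≡⇒gap eq)

  mismatches≡0⁻ : ∀ u v → mismatches u v ≡ 0 → ∀ {w} → w < n → mismatch u v w ≡ 0
  mismatches≡0⁻ u v none w<n =
    n≤0⇒n≡0 (≤-trans (term≤sumTo (mismatch u v) w<n) (≤-reflexive none))

  flag≡1⇒earlier≤1 : ∀ v → flag v ≡ 1 → earlier v ≤ 1
  flag≡1⇒earlier≤1 v kept with earlier v | trans (sym (flag-def v)) kept
  ... | 0           | _  = z≤n
  ... | 1           | _  = ≤-refl
  ... | suc (suc e) | eq = contradiction (trans (sym (0∸n≡0 e)) eq) λ ()

  flag≢1⇒1<earlier : ∀ v → flag v ≢ 1 → 1 < earlier v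
  flag≢1⇒1<earlier v dropped with earlier v | flag-def v
  ... | 0           | eq = contradiction eq dropped
  ... | 1           | eq = contradiction eq dropped
  ... | suc (suc _) | _  = s≤s (s≤s z≤n)

bit : Bool → ℕ
bit b = if b then 1 else 0

bit-injective : ∀ {a b} → bit a ≡ bit b → a ≡ b
bit-injective {true}  {true}  _ = refl
bit-injective {false} {false} _ = refl

matrix-entry : ∀ {n} (G : Graph n) i j → matrix G (n * toℕ i + toℕ j) ≡ bit (adj G i j)
matrix-entry {n} G i j with n * toℕ i + toℕ j <? n * n
... | yes c<n² = cong (λ q → bit (uncurry (adj G) q))
  (trans (cong (remQuot n) (toℕ-injective (trans (toℕ-fromℕ< c<n²) (sym (toℕ-combine i j)))))
         (remQuot-combine i j))
... | no c≮n² = contradiction (subst (_< n * n) (toℕ-combine i j) (toℕ<n (combine i j))) c≮n²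

module KeptTwins {n : ℕ} (G : Graph n) {Kept : Fin n → Set} (kept? : Decidable Kept)
  (two-earlier : ∀ {z} → ¬ Kept z →
    ∃[ x ] ∃[ y ] (x Fin.< y × y Fin.< z × Twin G x z × Twin G y z)) where

  TwoKeptTwins : Fin n → Set
  TwoKeptTwins v = ∃[ x ] ∃[ y ] (x ≢ y × Kept x × Kept y × Twin G x v × Twin G y v)

  -- An earlier twin may be dropped itself. Then the search descends to it, and its kept twins are
  -- twins of `v` by transitivity.
  ¬Kept⇒TwoKeptTwins : ∀ v → ¬ Kept v → TwoKeptTwins v
  ¬Kept⇒TwoKeptTwins v = below (suc (toℕ v)) v ≤-refl
    where
    along : ∀ {u v} → Twin G u v → TwoKeptTwins u → TwoKeptTwins v
    along t (x , y , x≢y , x-kept , y-kept , x~u , y~u) =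
      x , y , x≢y , x-kept , y-kept , Twin-trans G x~u t , Twin-trans G y~u t

    below : ∀ N v → toℕ v < N → ¬ Kept v → TwoKeptTwins v
    below (suc N) v (s≤s v≤N) dropped with two-earlier dropped
    ... | x , y , x<y , y<v , x~v , y~v with kept? x | kept? y
    ...   | yes x-kept | yes y-kept =
            x , y , (λ x≡y → <⇒≢ x<y (cong toℕ x≡y)) , x-kept , y-kept , x~v , y~v
    ...   | no x-dropped | _ = along x~v (below N x (<-≤-trans (<-trans x<y y<v) v≤N) x-dropped)
    ...   | yes _ | no y-dropped = along y~v (below N y (<-≤-trans y<v v≤N) y-dropped)

module Kernel {n : ℕ} (G : Graph n) where

  open Twins n (matrix G) public

  m : ℕ
  m = rank n

  mismatches≡0⇒Twin : ∀ {u v} → mismatches (toℕ u) (toℕ v) ≡ 0 → Twin G u v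
  mismatches≡0⇒Twin {u} {v} none w w≢u w≢v
    with mismatch≡0⁻ (toℕ u) (toℕ v) (toℕ w) (mismatches≡0⁻ (toℕ u) (toℕ v) none (toℕ<n w))
  ... | inj₁ w≡u        = contradiction (toℕ-injective w≡u) w≢u
  ... | inj₂ (inj₁ w≡v) = contradiction (toℕ-injective w≡v) w≢v
  ... | inj₂ (inj₂ eq)  =
    bit-injective (trans (sym (matrix-entry G u w)) (trans eq (matrix-entry G v w)))

  Twin⇒mismatches≡0 : ∀ {u v} → Twin G u v → mismatches (toℕ u) (toℕ v) ≡ 0
  Twin⇒mismatches≡0 {u} {v} t = sumTo≡0 (mismatch (toℕ u) (toℕ v)) n λ {w} w<n →
    subst (λ w → mismatch (toℕ u) (toℕ v) w ≡ 0) (toℕ-fromℕ< w<n)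
      (mismatch≡0⁺ (toℕ u) (toℕ v) _ (agree (fromℕ< w<n)))
    where
    agree : ∀ w → toℕ w ≡ toℕ u ⊎ toℕ w ≡ toℕ v ⊎
            matrix G (n * toℕ u + toℕ w) ≡ matrix G (n * toℕ v + toℕ w)
    agree w with w Fin.≟ u | w Fin.≟ v
    ... | yes w≡u | _       = inj₁ (cong toℕ w≡u)
    ... | no  _   | yes w≡v = inj₂ (inj₁ (cong toℕ w≡v))
    ... | no  w≢u | no  w≢v = inj₂ (inj₂
      (trans (matrix-entry G u w) (trans (cong bit (t w w≢u w≢v)) (sym (matrix-entry G v w)))))

  Kept : Fin n → Set
  Kept v = flag (toℕ v) ≡ 1

  is-twin : Fin n → ℕ → ℕ
  is-twin v u = 1 ∸ mismatches u (toℕ v)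

  two-earlier⇒¬Kept : ∀ {x y z} → x Fin.< y → y Fin.< z → Twin G x z → Twin G y z → ¬ Kept z
  two-earlier⇒¬Kept {x} {y} {z} x<y y<z t t′ kept = contradiction
    (≤-trans (≤-reflexive (sym (cong₂ _+_ (one t) (one t′))))
      (≤-trans (two-terms≤sumTo (is-twin z) x<y y<z) (flag≡1⇒earlier≤1 (toℕ z) kept)))
    λ { (s≤s ()) }
    where
    one : ∀ {u} → Twin G u z → is-twin z (toℕ u) ≡ 1
    one t = cong (1 ∸_) (Twin⇒mismatches≡0 t)

  ¬Kept⇒two-earlier : ∀ {z} → ¬ Kept z →
    ∃[ x ] ∃[ y ] (x Fin.< y × y Fin.< z × Twin G x z × Twin G y z)
  ¬Kept⇒two-earlier {z} dropped
    with i , j , i<j , j<z , i-twin , j-twin ←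
           two-positive-terms {is-twin z} (λ u → m∸n≤m 1 (mismatches u (toℕ z))) (toℕ z)
             (flag≢1⇒1<earlier (toℕ z) dropped) =
    fromℕ< i<n , fromℕ< j<n
    , subst₂ _<_ (sym (toℕ-fromℕ< i<n)) (sym (toℕ-fromℕ< j<n)) i<j
    , subst (_< toℕ z) (sym (toℕ-fromℕ< j<n)) j<z
    , twin i<n i-twin , twin j<n j-twin
    where
    j<n = <-trans j<z (toℕ<n z)
    i<n = <-trans i<j j<n

    twin : ∀ {u} (u<n : u < n) → 0 < is-twin z u → Twin G (fromℕ< u<n) z
    twin {u} u<n pos = mismatches≡0⇒Twin
      (trans (cong (λ u → mismatches u (toℕ z)) (toℕ-fromℕ< u<n)) (zero-mismatches pos))
      where
      zero-mismatches : 0 < is-twin z u → mismatches u (toℕ z) ≡ 0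
      zero-mismatches pos with mismatches u (toℕ z)
      ... | zero  = refl
      ... | suc e = contradiction (subst (0 <_) (0∸n≡0 e) pos) λ ()

  kept-vertex : (a : Fin m) → ∃[ v ] (Kept v × rank (toℕ v) ≡ toℕ a)
  kept-vertex a with i , i<n , kept , eq ← select flag≤1 n (toℕ<n a) =
    fromℕ< i<n , trans (cong flag (toℕ-fromℕ< i<n)) kept , trans (cong rank (toℕ-fromℕ< i<n)) eq

  K : Fin m → Fin n
  K a = proj₁ (kept-vertex a)

  K-kept : ∀ a → Kept (K a)
  K-kept a = proj₁ (proj₂ (kept-vertex a))

  rank-K : ∀ a → rank (toℕ (K a)) ≡ toℕ a
  rank-K a = proj₂ (proj₂ (kept-vertex a))

  K-injective : ∀ {a b} → K a ≡ K b → a ≡ b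
  K-injective {a} {b} eq =
    toℕ-injective (trans (sym (rank-K a)) (trans (cong (rank ∘ toℕ) eq) (rank-K b)))

  K-surjective : ∀ {v} → Kept v → ∃[ a ] (toℕ a ≡ rank (toℕ v) × K a ≡ v)
  K-surjective {v} kept = fromℕ< rank<m , toℕ-fromℕ< rank<m
    , toℕ-injective (sumTo-injective (K-kept _) kept
        (trans (rank-K (fromℕ< rank<m)) (toℕ-fromℕ< rank<m)))
    where
    rank<m : rank (toℕ v) < m
    rank<m = sumTo-<-term {flag} kept (toℕ<n v)

  H : Graph m
  H = record
    { adj         = λ a b → adj G (K a) (K b)
    ; symmetric   = λ a b → symmetric G (K a) (K b)
    ; irreflexive = λ a → irreflexive G (K a)
    }

  open KeptTwins G {Kept} (λ v → flag (toℕ v) ≟ 1) ¬Kept⇒two-earlier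

  reduction : IsReduction G H K
  reduction = record
    { injective = K-injective
    ; induced   = λ a b → refl
    ; two-twins = two-twins
    }
    where
    two-twins : ∀ v → (∀ a → K a ≢ v) →
                ∃[ a ] ∃[ b ] (a ≢ b × Twin G (K a) v × Twin G (K b) v)
    two-twins v v∉K = images (¬Kept⇒TwoKeptTwins v λ kept →
      let a , _ , Ka≡v = K-surjective kept in v∉K a Ka≡v)
      where
      images : TwoKeptTwins v → ∃[ a ] ∃[ b ] (a ≢ b × Twin G (K a) v × Twin G (K b) v)
      images (x , y , x≢y , x-kept , y-kept , x~v , y~v) =
        let a , _ , Ka≡x = K-surjective x-kept
            b , _ , Kb≡y = K-surjective y-kept
        in a , b , (λ a≡b → x≢y (trans (sym Ka≡x) (trans (cong K a≡b) Kb≡y)))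
           , subst (λ u → Twin G u v) (sym Ka≡x) x~v
           , subst (λ u → Twin G u v) (sym Kb≡y) y~v

  -- The last of three mutual twins has two earlier ones and would have been dropped; the cases
  -- determine which is last.
  kept-thin : ∀ {x y z} → Kept x → Kept y → Kept z → x ≢ y → x ≢ z → y ≢ z →
              Twin G x y → Twin G x z → ⊥
  kept-thin {x} {y} {z} x-kept y-kept z-kept x≢y x≢z y≢z x~y x~z
    with Fin.<-cmp x y | Fin.<-cmp x z | Fin.<-cmp y z
  ... | tri≈ _ x≡y _ | _ | _ = x≢y x≡y
  ... | _ | tri≈ _ x≡z _ | _ = x≢z x≡z
  ... | _ | _ | tri≈ _ y≡z _ = y≢z y≡z
  ... | tri< x<y _ _ | _ | tri< y<z _ _ =
    two-earlier⇒¬Kept x<y y<z x~z (Twin-trans G (Twin-sym G x~y) x~z) z-kept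
  ... | _ | tri< x<z _ _ | tri> _ _ z<y =
    two-earlier⇒¬Kept x<z z<y x~y (Twin-trans G (Twin-sym G x~z) x~y) y-kept
  ... | tri> _ _ y<x | tri< x<z _ _ | _ =
    two-earlier⇒¬Kept y<x x<z (Twin-trans G (Twin-sym G x~y) x~z) x~z z-kept
  ... | tri< x<y _ _ | tri> _ _ z<x | _ =
    two-earlier⇒¬Kept z<x x<y (Twin-trans G (Twin-sym G x~z) x~y) x~y y-kept
  ... | tri> _ _ y<x | tri> _ _ z<x | tri< y<z _ _ =
    two-earlier⇒¬Kept y<z z<x (Twin-sym G x~y) (Twin-sym G x~z) x-kept
  ... | tri> _ _ y<x | tri> _ _ z<x | tri> _ _ z<y =
    two-earlier⇒¬Kept z<y y<x (Twin-sym G x~z) (Twin-sym G x~y) x-kept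

  kept-large⇒Saved : ∀ k → 8 * k ^ 4 < m → Saved G k
  kept-large⇒Saved k large = large⇒Saved G (Unique.tabulate⁺ K-injective) thin k
    (≤-trans (<⇒≤ large) (≤-reflexive (sym (length-tabulate K))))
    where
    L∋⇒Kept : ∀ {x} → x ∈ tabulate K → Kept x
    L∋⇒Kept x∈ with a , refl ← ∈-tabulate⁻ x∈ = K-kept a

    thin : ∀ {x y z} → x ∈ tabulate K → y ∈ tabulate K → z ∈ tabulate K → x ≢ y → x ≢ z → y ≢ z →
           Twin G x y → Twin G x z → ⊥
    thin x∈ y∈ z∈ = kept-thin (L∋⇒Kept x∈) (L∋⇒Kept y∈) (L∋⇒Kept z∈)

empty : Graph 0
empty = record { adj = λ () ; symmetric = λ () ; irreflexive = λ () }

bound : ℕ → ℕ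
bound k = 8 * k ^ 4

-- Above the bound the answer is known to be yes, and the graph without vertices, with nothing to
-- save, is a yes-instance.
kernelize : Instance → Instance
kernelize record { order = n ; graph = G ; parameter = k } with m ≤? bound k
  where open Kernel G
... | yes _ = record { order = Kernel.m G ; graph = Kernel.H G ; parameter = k }
... | no  _ = record { order = 0 ; graph = empty ; parameter = 0 }

kernelize-equivalent : ∀ I → SavingLandmarks I ⇔ SavingLandmarks (kernelize I)
kernelize-equivalent I@record { order = n ; graph = G ; parameter = k }
  with Kernel.m G ≤? bound k
... | yes _ = mk⇔
  (from (SavingLandmarks⇔Saved _) ∘ Saved-restrict reduction ∘ to (SavingLandmarks⇔Saved I))
  (from (SavingLandmarks⇔Saved I) ∘ Saved-extend reduction ∘ to (SavingLandmarks⇔Saved _))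
  where open Kernel G
... | no large = mk⇔
  (λ _ → from (SavingLandmarks⇔Saved _) ((λ ()) , λ {}))
  (λ _ → from (SavingLandmarks⇔Saved I) (Kernel.kept-large⇒Saved G k (≰⇒> large)))

order-kernelize : ∀ I → order (kernelize I) ≤ 8 * parameter I ^ 4
order-kernelize record { order = n ; graph = G ; parameter = k } with Kernel.m G ≤? bound k
... | yes small = small
... | no  _     = z≤n

parameter-kernelize : ∀ I → parameter (kernelize I) ≤ parameter I
parameter-kernelize record { order = n ; graph = G ; parameter = k } with Kernel.m G ≤? bound k
... | yes _ = ≤-refl
... | no  _ = z≤n

order-kernelize≤order : ∀ I → order (kernelize I) ≤ order I
order-kernelize≤order record { order = n ; graph = G ; parameter = k } with Kernel.m G ≤? bound k
... | yes _ = sumTo-≤ (Kernel.flag≤1 G) n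
... | no  _ = z≤n

-- Running times and correctness of programs

-- The base `suc N` is positive, so powers increase with the exponent and bounds of different
-- degrees can be added.
PolyBounded : (ℕ → ℕ) → Set
PolyBounded f = ∃[ c ] ∃[ d ] (∀ N → f N ≤ c * suc N ^ d)

PolyBounded-const : ∀ a → PolyBounded (λ _ → a)
PolyBounded-const a = a , 0 , λ N → ≤-reflexive (sym (*-identityʳ a))

PolyBounded-id : PolyBounded id
PolyBounded-id = 1 , 1 , λ N → ≤-trans (n≤1+n N)
  (≤-reflexive (sym (trans (*-identityˡ _) (*-identityʳ (suc N)))))

PolyBounded-+ : ∀ {f g} → PolyBounded f → PolyBounded g → PolyBounded (λ N → f N + g N)
PolyBounded-+ {f} {g} (c , d , f≤) (c′ , d′ , g≤) = c + c′ , d + d′ , λ N → begin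
  f N + g N                                        ≤⟨ +-mono-≤ (f≤ N) (g≤ N) ⟩
  c * suc N ^ d + c′ * suc N ^ d′
    ≤⟨ +-mono-≤ (*-monoʳ-≤ c (^-monoʳ-≤ (suc N) (m≤m+n d d′)))
                (*-monoʳ-≤ c′ (^-monoʳ-≤ (suc N) (m≤n+m d′ d))) ⟩
  c * suc N ^ (d + d′) + c′ * suc N ^ (d + d′)     ≡⟨ *-distribʳ-+ (suc N ^ (d + d′)) c c′ ⟨
  (c + c′) * suc N ^ (d + d′)                      ∎
  where open ≤-Reasoning

PolyBounded-* : ∀ {f g} → PolyBounded f → PolyBounded g → PolyBounded (λ N → f N * g N)
PolyBounded-* {f} {g} (c , d , f≤) (c′ , d′ , g≤) = c * c′ , d + d′ , λ N → begin
  f N * g N                            ≤⟨ *-mono-≤ (f≤ N) (g≤ N) ⟩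
  c * suc N ^ d * (c′ * suc N ^ d′)    ≡⟨ [m*n]*[o*p]≡[m*o]*[n*p] c (suc N ^ d) c′ _ ⟩
  c * c′ * (suc N ^ d * suc N ^ d′)    ≡⟨ cong (c * c′ *_) (^-distribˡ-+-* (suc N) d d′) ⟨
  c * c′ * suc N ^ (d + d′)            ∎
  where
  open ≤-Reasoning

^-distrib-* : ∀ m n d → (m * n) ^ d ≡ m ^ d * n ^ d
^-distrib-* m n zero    = refl
^-distrib-* m n (suc d) =
  trans (cong (m * n *_) (^-distrib-* m n d)) ([m*n]*[o*p]≡[m*o]*[n*p] m n (m ^ d) (n ^ d))

PolyBounded⇒≤ : ∀ {f} → PolyBounded f → ∃[ c ] ∃[ d ] (∀ N → f N ≤ c * N ^ d + c)
PolyBounded⇒≤ {f} (c , d , f≤) = c * 2 ^ d , d , λ N → ≤-trans (f≤ N) (shifted N)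
  where
  open ≤-Reasoning
  shifted : ∀ N → c * suc N ^ d ≤ c * 2 ^ d * N ^ d + c * 2 ^ d
  shifted zero = begin
    c * 1 ^ d                            ≤⟨ *-monoʳ-≤ c (^-monoˡ-≤ d (s≤s (z≤n {1}))) ⟩
    c * 2 ^ d                            ≤⟨ m≤n+m _ _ ⟩
    c * 2 ^ d * 0 ^ d + c * 2 ^ d        ∎
  shifted (suc N) = begin
    c * suc (suc N) ^ d                  ≤⟨ *-monoʳ-≤ c (^-monoˡ-≤ d (s≤s (m≤n+m (suc N) N))) ⟩
    c * (suc N + suc N) ^ d              ≡⟨ cong (λ x → c * (suc N + x) ^ d) (+-identityʳ (suc N)) ⟨
    c * (2 * suc N) ^ d                  ≡⟨ cong (c *_) (^-distrib-* 2 (suc N) d) ⟩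
    c * (2 ^ d * suc N ^ d)              ≡⟨ *-assoc c _ _ ⟨
    c * 2 ^ d * suc N ^ d                ≤⟨ m≤m+n _ _ ⟩
    c * 2 ^ d * suc N ^ d + c * 2 ^ d    ∎

-- Running time when every loop of the program makes at most N iterations.
steps : Program → ℕ → ℕ
steps skip                 N = 1
steps (x ≔ e)              N = 1 + cost e
steps (a [ e ]≔ f)         N = 1 + cost e + cost f
steps (p ⨾ q)              N = steps p N + steps q N
steps (If e Then p Else q) N = 1 + cost e + (steps p N + steps q N)
steps (While e Do p)       N = 1 + cost e + N * (1 + cost e + steps p N)

steps-polynomial : ∀ p → PolyBounded (steps p)
steps-polynomial skip                 = PolyBounded-const 1
steps-polynomial (x ≔ e)              = PolyBounded-const _
steps-polynomial (a [ e ]≔ f)         = PolyBounded-const _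
steps-polynomial (p ⨾ q)              = PolyBounded-+ (steps-polynomial p) (steps-polynomial q)
steps-polynomial (If e Then p Else q) = PolyBounded-+ (PolyBounded-const (1 + cost e))
  (PolyBounded-+ (steps-polynomial p) (steps-polynomial q))
steps-polynomial (While e Do p)       = PolyBounded-+ (PolyBounded-const (1 + cost e))
  (PolyBounded-* PolyBounded-id (PolyBounded-+ (PolyBounded-const (1 + cost e)) (steps-polynomial p)))

assigned : ℕ → Expr → Memory → Memory
assigned x e s = memory (registers s [ x ↦ ⟦ e ⟧ s ]) (arrays s)

stored : ℕ → Expr → Expr → Memory → Memory
stored a e f s = memory (registers s) (arrays s [ a ↦ arrays s a [ ⟦ e ⟧ s ↦ ⟦ f ⟧ s ] ])

update-same : ∀ (f : ℕ → ℕ) {i j a} → i ≡ j → (f [ i ↦ a ]) j ≡ a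
update-same f {i} refl with i ≡ᵇ i | ≡⇒≡ᵇ i i refl
... | true | _ = refl

update-other : ∀ (f : ℕ → ℕ) {i j a} → i ≢ j → (f [ i ↦ a ]) j ≡ f j
update-other f {i} {j} i≢j with i ≡ᵇ j | ≡ᵇ⇒≡ i j
... | true  | i≡j = contradiction (i≡j _) i≢j
... | false | _   = refl

module Runs (N : ℕ) where

  -- Total correctness with a time bound. The single `N` bounds the iterations of every loop, so
  -- times compose along the syntax.
  Run : Program → Memory → (Memory → Set) → Set
  Run p s Q = ∃[ t ] ∃[ s′ ] (⟨ p , s ⟩⇓[ t ] s′ × Q s′ × t ≤ steps p N)

  module _ {Q : Memory → Set} where

    assign : ∀ {x e s} → Q (assigned x e s) → Run (x ≔ e) s Q
    assign q = _ , _ , ⇓assign , q , ≤-refl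

    infixr 3 _then_
    _then_ : ∀ {R p q s} → Run p s R → (∀ {s′} → R s′ → Run q s′ Q) → Run (p ⨾ q) s Q
    (t , s′ , run , r , t≤) then next with u , s″ , run′ , q , u≤ ← next r =
      t + u , s″ , ⇓seq run run′ , q , +-mono-≤ t≤ u≤

    assign-then : ∀ {x e q s} → Run q (assigned x e s) Q → Run (x ≔ e ⨾ q) s Q
    assign-then (u , s″ , run , q , u≤) = _ , s″ , ⇓seq ⇓assign run , q , +-monoʳ-≤ _ u≤

    store-then : ∀ {a e f q s} → Run q (stored a e f s) Q → Run (a [ e ]≔ f ⨾ q) s Q
    store-then (u , s″ , run , q , u≤) = _ , s″ , ⇓seq ⇓store run , q , +-monoʳ-≤ _ u≤

    if-then : ∀ {e p q s} → ⟦ e ⟧ s ≢ 0 → Run p s Q → Run (If e Then p Else q) s Q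
    if-then {e} {p} {q} e≢0 (t , s′ , run , post , t≤) =
      _ , s′ , ⇓then e≢0 run , post , +-monoʳ-≤ (1 + cost e) (≤-trans t≤ (m≤m+n _ (steps q N)))

    if-else : ∀ {e p q s} → ⟦ e ⟧ s ≡ 0 → Run q s Q → Run (If e Then p Else q) s Q
    if-else {e} {p} {q} e≡0 (t , s′ , run , post , t≤) =
      _ , s′ , ⇓else e≡0 run , post , +-monoʳ-≤ (1 + cost e) (≤-trans t≤ (m≤n+m _ (steps p N)))

  module _ {e p B} (Inv : ℕ → Memory → Set)
    (guard : ∀ {i s} → Inv i s → ⟦ e ⟧ s ≡ B ∸ i)
    (body : ∀ {i s} → i < B → Inv i s → Run p s (Inv (suc i))) where

    -- All loops count up to a bound: the guard evaluates to `B ∸ i`, so exactly `B` rounds are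
    -- made. The induction is on the rounds `r` still to come.
    iterate : ∀ r i {s} → r + i ≡ B → Inv i s → ∃[ t ] ∃[ s′ ]
      (⟨ While e Do p , s ⟩⇓[ t ] s′ × Inv B s′ × t ≤ 1 + cost e + r * (1 + cost e + steps p N))
    iterate zero i refl inv =
      _ , _ , ⇓done (trans (guard inv) (n∸n≡0 B)) , inv , m≤m+n _ _
    iterate (suc r) i eq inv
      with t , s′ , run , inv′ , t≤ ← body (subst (i <_) eq (s≤s (m≤n+m i r))) inv
      with u , s″ , runs , inv″ , u≤ ← iterate r (suc i) (trans (+-suc r i) eq) inv′ =
      _ , s″ , ⇓loop positive run runs , inv″ , fast
      where
      positive : ⟦ e ⟧ _ ≢ 0
      positive e≡0 = m>n⇒m∸n≢0 (subst (i <_) eq (s≤s (m≤n+m i r))) (trans (sym (guard inv)) e≡0)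

      fast : 1 + cost e + t + u ≤ 1 + cost e + suc r * (1 + cost e + steps p N)
      fast = begin
        1 + cost e + t + u
          ≤⟨ +-mono-≤ (+-monoʳ-≤ (1 + cost e) t≤) u≤ ⟩
        c + (1 + cost e + r * c)    ≡⟨ +-comm c _ ⟩
        1 + cost e + r * c + c      ≡⟨ +-assoc (1 + cost e) (r * c) c ⟩
        1 + cost e + (r * c + c)    ≡⟨ cong (1 + cost e +_) (+-comm (r * c) c) ⟩
        1 + cost e + (c + r * c)    ∎
        where
        open ≤-Reasoning
        c = 1 + cost e + steps p N

    while : B ≤ N → ∀ {s} → Inv 0 s → Run (While e Do p) s (Inv B)
    while B≤N inv with t , s′ , run , inv′ , t≤ ← iterate B 0 (+-identityʳ B) inv =
      t , s′ , run , inv′ , ≤-trans t≤ (+-monoʳ-≤ (1 + cost e) (*-monoˡ-≤ _ B≤N))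

-- The program computing the kernel

gapₑ meetₑ : Expr → Expr → Expr
gapₑ e f  = (e ⊖ f) ⊕ (f ⊖ e)
meetₑ e f = e ⊖ (e ⊖ f)

-- rnv and rnu hold n * v and n * u, since the machine cannot multiply; rq and rp are the
-- positions in the adjacency matrix at which compress reads and writes.
pattern rn   = 0
pattern rk   = 1
pattern rb   = 2
pattern racc = 3
pattern ri   = 4
pattern rm   = 5
pattern rv   = 6
pattern rnv  = 7
pattern ru   = 8
pattern rnu  = 9
pattern rcnt = 10
pattern rw   = 11
pattern rmis = 12
pattern rq   = 13
pattern rp   = 14

scale-step : Program
scale-step = racc ≔ reg racc ⊕ reg rb ⨾ ri ≔ reg ri ⊕ const 1

-- Multiplication by k as repeated addition, which is affordable because the parameter counts in
-- unary towards the instance size.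
scale : Program
scale =
  racc ≔ const 0 ⨾
  ri ≔ const 0 ⨾
  While (reg rk ⊖ reg ri) Do scale-step ⨾
  rb ≔ reg racc

compute-bound : Program
compute-bound = rb ≔ const 8 ⨾ scale ⨾ scale ⨾ scale ⨾ scale

flagₑ : Expr
flagₑ = const 1 ⊖ (reg rcnt ⊖ const 1)

mismatchₑ : Expr
mismatchₑ = meetₑ (meetₑ (gapₑ (reg rw) (reg ru)) (gapₑ (reg rw) (reg rv)))
                  (gapₑ (arr 0 (reg rnu ⊕ reg rw)) (arr 0 (reg rnv ⊕ reg rw)))

compare-step : Program
compare-step = rmis ≔ reg rmis ⊕ mismatchₑ ⨾ rw ≔ reg rw ⊕ const 1

count-step : Program
count-step =
  rmis ≔ const 0 ⨾
  rw ≔ const 0 ⨾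
  While (reg rn ⊖ reg rw) Do compare-step ⨾
  rcnt ≔ reg rcnt ⊕ (const 1 ⊖ reg rmis) ⨾
  rnu ≔ reg rnu ⊕ reg rn ⨾
  ru ≔ reg ru ⊕ const 1

mark-step : Program
mark-step =
  rcnt ≔ const 0 ⨾
  rnu ≔ const 0 ⨾
  ru ≔ const 0 ⨾
  While (reg rv ⊖ reg ru) Do count-step ⨾
  1 [ reg rv ]≔ flagₑ ⨾
  rm ≔ reg rm ⊕ flagₑ ⨾
  rnv ≔ reg rnv ⊕ reg rn ⨾
  rv ≔ reg rv ⊕ const 1

mark : Program
mark = While (reg rn ⊖ reg rv) Do mark-step

-- The write is unconditional: unless both v and w are kept, rp stays and the cell is
-- overwritten by the next write.
copy-step : Program
copy-step =
  0 [ reg rp ]≔ arr 0 (reg rq) ⨾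
  rp ≔ reg rp ⊕ meetₑ (arr 1 (reg rv)) (arr 1 (reg rw)) ⨾
  rq ≔ reg rq ⊕ const 1 ⨾
  rw ≔ reg rw ⊕ const 1

copy-row : Program
copy-row =
  rw ≔ const 0 ⨾
  While (reg rn ⊖ reg rw) Do copy-step ⨾
  rv ≔ reg rv ⊕ const 1

compress : Program
compress =
  rv ≔ const 0 ⨾
  While (reg rn ⊖ reg rv) Do copy-row ⨾
  rn ≔ reg rm

answer-yes : Program
answer-yes = rn ≔ const 0 ⨾ rk ≔ const 0

finish : Program
finish = If reg rm ⊖ reg rb Then answer-yes Else compress

kernel-program : Program
kernel-program = compute-bound ⨾ mark ⨾ finish

-- Correctness of the kernel program

module Correct (I : Instance) where

  n = order I
  k = parameter I
  G = graph I
  A = matrix G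
  N = instanceSize I

  open Runs N
  open Kernel G

  n≤N : n ≤ N
  n≤N = ≤-trans (m≤m+n n (n * n)) (m≤m+n (n + n * n) k)

  k≤N : k ≤ N
  k≤N = m≤n+m k (n + n * n)

  -- The invariants are products of equations between constant cells of the memory and
  -- numbers, so an invariant proved before an assignment to another cell holds after it
  -- by computation.
  Sized : ℕ → Memory → Set
  Sized b s = registers s rn ≡ n × registers s rk ≡ k × registers s rb ≡ b

  -- These registers are used later without being initialised; marking or copying relies on their
  -- initial zeros.
  Unread : Memory → Set
  Unread s = (∀ c → arrays s 0 c ≡ A c) × registers s rm ≡ 0 × registers s rv ≡ 0 ×
             registers s rnv ≡ 0 × registers s rq ≡ 0 × registers s rp ≡ 0

  Start : ℕ → Memory → Set
  Start b s = Sized b s × Unread s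

  Scaling : ℕ → ℕ → Memory → Set
  Scaling b i s = Start b s × registers s ri ≡ i × registers s racc ≡ i * b

  scale-correct : ∀ {b s} → Start b s → Run scale s (Start (k * b))
  scale-correct {b} start = assign-then (assign-then
    (while (Scaling b)
      (λ { (((_ , k-eq , _) , _) , i-eq , _) → cong₂ _∸_ k-eq i-eq })
      (λ { {i} _ (start@((_ , _ , b-eq) , _) , i-eq , acc-eq) → assign-then (assign
        (start , trans (cong (_+ 1) i-eq) (+-comm i 1)
        , trans (cong₂ _+_ acc-eq b-eq) (+-comm (i * b) b))) })
      k≤N (start , refl , refl)
    then λ { (((n-eq , k-eq , _) , unread) , _ , acc-eq) →
      assign ((n-eq , k-eq , acc-eq) , unread) }))

  compute-bound-correct : ∀ {s b} → Start b s → Run compute-bound s (Start (bound k))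
  compute-bound-correct ((n-eq , k-eq , _) , unread) =
    assign-then {Start (bound k)} (scale-correct ((n-eq , k-eq , refl) , unread)
    then λ start → scale-correct start
    then λ start → scale-correct start
    then λ {s} start → subst (λ b → Run scale s (Start b)) power (scale-correct start))
    where
    open +-*-Solver
    power : k * (k * (k * (k * 8))) ≡ 8 * k ^ 4
    power = solve 1 (λ k → k :* (k :* (k :* (k :* con 8))) := con 8 :* k :^ 4) refl k

  Marking : ℕ → Memory → Set
  Marking v s = Sized (bound k) s × (∀ c → arrays s 0 c ≡ A c) ×
    registers s rv ≡ v × registers s rnv ≡ n * v × registers s rm ≡ rank v ×
    (∀ c → c < v → arrays s 1 c ≡ flag c) ×
    registers s rq ≡ 0 × registers s rp ≡ 0

  Counting : ℕ → ℕ → Memory → Set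
  Counting v u s = Marking v s × registers s ru ≡ u × registers s rnu ≡ n * u ×
    registers s rcnt ≡ sumTo (λ u → 1 ∸ mismatches u v) u

  Comparing : ℕ → ℕ → ℕ → Memory → Set
  Comparing v u w s = Counting v u s × registers s rw ≡ w ×
    registers s rmis ≡ sumTo (mismatch u v) w

  mismatch-value : ∀ {u v w u′ v′ w′ a b} → w′ ≡ w → u′ ≡ u → v′ ≡ v →
    a ≡ A (n * u + w) → b ≡ A (n * v + w) →
    meet (meet (gap w′ u′) (gap w′ v′)) (gap a b) ≡ mismatch u v w
  mismatch-value refl refl refl refl refl = refl

  next : ∀ {x i} → x ≡ i → x + 1 ≡ suc i
  next {i = i} refl = +-comm i 1

  next-row : ∀ {x y i} → x ≡ n * i → y ≡ n → x + y ≡ n * suc i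
  next-row {i = i} refl refl = trans (+-comm (n * i) n) (sym (*-suc n i))

  compare-correct : ∀ {v u w s} → w < n → Comparing v u w s →
                    Run compare-step s (Comparing v u (suc w))
  compare-correct {v} {u} {w} {s} _
    (inv@((_ , A-eq , v-eq , nv-eq , _) , u-eq , nu-eq , _) , w-eq , mis-eq) =
    assign-then (assign (inv , next w-eq , cong₂ _+_ mis-eq
      (mismatch-value w-eq u-eq v-eq (cell nu-eq) (cell nv-eq))))
    where
    cell : ∀ {x i} → x ≡ n * i → arrays s 0 (x + registers s rw) ≡ A (n * i + w)
    cell eq = trans (A-eq _) (cong A (cong₂ _+_ eq w-eq))

  count-correct : ∀ {v u s} → u < v → Counting v u s → Run count-step s (Counting v (suc u))
  count-correct {v} {u} _ inv = assign-then (assign-then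
    (while (Comparing v u)
      (λ { ((((n-eq , _) , _) , _) , w-eq , _) → cong₂ _∸_ n-eq w-eq })
      compare-correct n≤N (inv , refl , refl)
    then λ { ((marking@((n-eq , _) , _) , u-eq , nu-eq , cnt-eq) , _ , mis-eq) →
      assign-then (assign-then (assign
        (marking , next u-eq , next-row nu-eq n-eq , cong₂ _+_ cnt-eq (cong (1 ∸_) mis-eq)))) }))

  mark-correct : ∀ {v s} → v < n → Marking v s → Run mark-step s (Marking (suc v))
  mark-correct {v} v<n inv = assign-then (assign-then (assign-then
    (while (Counting v)
      (λ { ((_ , _ , v-eq , _) , u-eq , _) → cong₂ _∸_ v-eq u-eq })
      count-correct (≤-trans (<⇒≤ v<n) n≤N) (inv , refl , sym (*-zeroʳ n) , refl)
    then λ { {s} ((sized@(n-eq , _) , A-eq , v-eq , nv-eq , m-eq , flags , rest) , _ , _ , cnt-eq) →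
      store-then (assign-then (assign-then (assign
        ( sized , A-eq , next v-eq , next-row nv-eq n-eq
        , cong₂ _+_ m-eq (flag-value cnt-eq)
        , flags′ (arrays s 1) v-eq flags (flag-value cnt-eq)
        , rest )))) })))
    where
    flag-value : ∀ {x} → x ≡ earlier v → 1 ∸ (x ∸ 1) ≡ flag v
    flag-value refl = sym (flag-def v)

    flags′ : ∀ f {x a} → x ≡ v → (∀ c → c < v → f c ≡ flag c) → a ≡ flag v →
             ∀ c → c < suc v → (f [ x ↦ a ]) c ≡ flag c
    flags′ f refl flags a-eq c (s≤s c≤v) with m≤n⇒m<n∨m≡n c≤v
    ... | inj₁ c<v  = trans (update-other f (≢-sym (<⇒≢ c<v))) (flags c c<v)
    ... | inj₂ refl = trans (update-same f refl) a-eq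

  Marked : Memory → Set
  Marked s = registers s rn ≡ n × registers s rk ≡ k × registers s rm ≡ m ×
             (∀ c → c < n → arrays s 1 c ≡ flag c)

  -- The q first cells of the input have been read and the p first cells of the output
  -- written, over the input.
  Cells : ℕ → ℕ → Memory → Set
  Cells q p s = registers s rq ≡ q × registers s rp ≡ p × p ≤ q ×
    (∀ c → c < p → arrays s 0 c ≡ matrix H c) × (∀ c → q ≤ c → arrays s 0 c ≡ A c)

  Row : ℕ → Memory → Set
  Row v s = Marked s × registers s rv ≡ v × Cells (n * v) (m * rank v) s

  -- The kept rows before `v` have filled `m` cells each; row `v` adds `rank w` cells if it is kept
  -- and none otherwise.
  Column : ℕ → ℕ → Memory → Set
  Column v w s = Marked s × registers s rv ≡ v × registers s rw ≡ w ×
                 Cells (n * v + w) (m * rank v + flag v * rank w) s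

  output-cell : ∀ {v w} → v < n → w < n → flag v ≡ 1 → flag w ≡ 1 →
                matrix H (m * rank v + rank w) ≡ A (n * v + w)
  output-cell {v} {w} v<n w<n v-kept w-kept
    with a , a-rank , Ka ← K-surjective {fromℕ< v<n} (trans (cong flag (toℕ-fromℕ< v<n)) v-kept)
    with b , b-rank , Kb ← K-surjective {fromℕ< w<n} (trans (cong flag (toℕ-fromℕ< w<n)) w-kept) =
    begin
      matrix H (m * rank v + rank w)
        ≡⟨ cong₂ (λ x y → matrix H (m * x + y)) (rank≡ v<n a-rank) (rank≡ w<n b-rank) ⟩
      matrix H (m * toℕ a + toℕ b)                          ≡⟨ matrix-entry H a b ⟩
      bit (adj G (K a) (K b))                               ≡⟨ cong₂ (λ x y → bit (adj G x y)) Ka Kb ⟩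
      bit (adj G (fromℕ< v<n) (fromℕ< w<n))                 ≡⟨ matrix-entry G _ _ ⟨
      A (n * toℕ (fromℕ< v<n) + toℕ (fromℕ< w<n))
        ≡⟨ cong₂ (λ x y → A (n * x + y)) (toℕ-fromℕ< v<n) (toℕ-fromℕ< w<n) ⟩
      A (n * v + w)                                         ∎
    where
    open ≡-Reasoning
    rank≡ : ∀ {v x} (v<n : v < n) → x ≡ rank (toℕ (fromℕ< v<n)) → rank v ≡ x
    rank≡ v<n eq = trans (cong rank (sym (toℕ-fromℕ< v<n))) (sym eq)

  flag-cases : ∀ v → flag v ≡ 0 ⊎ flag v ≡ 1
  flag-cases v with flag v | flag≤1 v
  ... | 0           | _      = inj₁ refl
  ... | 1           | _      = inj₂ refl
  ... | suc (suc _) | s≤s ()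

  meet-flags : ∀ v w → meet (flag v) (flag w) ≡ flag v * flag w
  meet-flags v w with flag v | flag w | flag-cases v | flag-cases w
  ... | _ | b | inj₁ refl | _         = meet-zeroˡ b refl
  ... | _ | _ | inj₂ refl | inj₁ refl = refl
  ... | _ | _ | inj₂ refl | inj₂ refl = refl

  position : ℕ → ℕ → ℕ
  position v w = m * rank v + flag v * rank w

  position-suc : ∀ v w → position v w + flag v * flag w ≡ position v (suc w)
  position-suc v w = trans (+-assoc (m * rank v) _ _)
    (cong (m * rank v +_) (sym (*-distribˡ-+ (flag v) (rank w) (flag w))))

  -- The writing position moves only if `v` and `w` are both kept, and then by a single cell.
  new-cell : ∀ {v w c} → v < n → w < n → position v w ≤ c → c < position v (suc w) →
             position v w ≡ c × matrix H c ≡ A (n * v + w)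
  new-cell {v} {w} {c} v<n w<n p≤c c<p′ with flag-cases v | flag-cases w
  ... | inj₁ v-dropped | _ = contradiction p≤c (<⇒≱ (subst (c <_) (trans
    (sym (position-suc v w)) (trans (cong (λ x → position v w + x * flag w) v-dropped)
      (+-identityʳ _))) c<p′))
  ... | inj₂ _ | inj₁ w-dropped = contradiction p≤c (<⇒≱ (subst (c <_) (trans
    (sym (position-suc v w)) (trans (cong (λ x → position v w + flag v * x) w-dropped)
      (trans (cong (position v w +_) (*-zeroʳ (flag v))) (+-identityʳ _)))) c<p′))
  ... | inj₂ v-kept | inj₂ w-kept = p≡c , trans (cong (matrix H) (trans (sym p≡c) p≡))
                                              (output-cell v<n w<n v-kept w-kept)
    where
    p≡ : position v w ≡ m * rank v + rank w
    p≡ = cong (m * rank v +_) (trans (cong (_* rank w) v-kept) (*-identityˡ (rank w)))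

    p≡c : position v w ≡ c
    p≡c = ≤-antisym p≤c (s≤s⁻¹ (subst (c <_) (trans (sym (position-suc v w))
      (trans (cong₂ (λ x y → position v w + x * y) v-kept w-kept) (+-comm _ 1))) c<p′))

  -- Overwriting is safe as the writing position advances by at most one per entry read and so never
  -- passes the reading position. A stray last value can remain only beyond the output, where
  -- nothing is required.
  copy-correct : ∀ {v w s} → v < n → w < n → Column v w s → Run copy-step s (Column v (suc w))
  copy-correct {v} {w} {s} v<n w<n
    (marked@(_ , _ , _ , flags) , v-eq , w-eq , q-eq , p-eq , p≤q , written , unread) =
    store-then (assign-then (assign-then (assign
      ( marked , v-eq , next w-eq , trans (next q-eq) (sym (+-suc (n * v) w))
      , trans (cong₂ _+_ p-eq (trans (cong₂ meet (flag-at v-eq v<n) (flag-at w-eq w<n))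
          (meet-flags v w))) (position-suc v w)
      , p′≤q′ , written′ , unread′ ))))
    where
    flag-at : ∀ {x i} → x ≡ i → i < n → arrays s 1 x ≡ flag i
    flag-at refl i<n = flags _ i<n

    p′≤q′ : position v (suc w) ≤ n * v + suc w
    p′≤q′ = begin
      position v (suc w)               ≡⟨ position-suc v w ⟨
      position v w + flag v * flag w   ≤⟨ +-mono-≤ p≤q (*-mono-≤ (flag≤1 v) (flag≤1 w)) ⟩
      n * v + w + 1                    ≡⟨ +-assoc (n * v) w 1 ⟩
      n * v + (w + 1)                  ≡⟨ cong (n * v +_) (+-comm w 1) ⟩
      n * v + suc w                    ∎
      where open ≤-Reasoning

    cells : ℕ → ℕ
    cells = arrays s 0 [ registers s rp ↦ arrays s 0 (registers s rq) ]

    written′ : ∀ c → c < position v (suc w) → cells c ≡ matrix H c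
    written′ c c<p′ with c <? position v w
    ... | yes c<p = trans (update-other (arrays s 0) (λ p≡c → <⇒≢ c<p (trans (sym p≡c) p-eq)))
                          (written c c<p)
    ... | no  c≮p with p≡c , cell ← new-cell v<n w<n (≮⇒≥ c≮p) c<p′ =
      trans (update-same (arrays s 0) (trans p-eq p≡c))
        (trans (cong (arrays s 0) q-eq) (trans (unread _ ≤-refl) (sym cell)))

    unread′ : ∀ c → n * v + suc w ≤ c → cells c ≡ A c
    unread′ c q<c = trans (update-other (arrays s 0) (λ p≡c → <⇒≢ p<c (trans (sym p-eq) p≡c)))
                          (unread c (≤-trans (+-monoʳ-≤ (n * v) (n≤1+n w)) q<c))
      where
      p<c : position v w < c
      p<c = ≤-trans (s≤s p≤q) (≤-trans (≤-reflexive (sym (+-suc (n * v) w))) q<c)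

  copy-row-correct : ∀ {v s} → v < n → Row v s → Run copy-row s (Row (suc v))
  copy-row-correct {v} {s} v<n (marked , v-eq , q-eq , p-eq , p≤q , written , unread) = assign-then
    (while (Column v)
      (λ { ((n-eq , _) , _ , w-eq , _) → cong₂ _∸_ n-eq w-eq })
      (copy-correct v<n) n≤N
      (marked , v-eq , refl , at-row-start)
    then λ { {s} (marked , v-eq , _ , cells) → assign (marked , next v-eq , at-row-end s cells) })
    where
    Cells-cong : ∀ s {q q′ p p′} → q ≡ q′ → p ≡ p′ → Cells q p s → Cells q′ p′ s
    Cells-cong s refl refl cells = cells

    at-row-start : Cells (n * v + 0) (position v 0) s
    at-row-start = Cells-cong s (sym (+-identityʳ (n * v)))
      (sym (trans (cong (m * rank v +_) (*-zeroʳ (flag v))) (+-identityʳ (m * rank v))))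
      (q-eq , p-eq , p≤q , written , unread)

    at-row-end : ∀ s → Cells (n * v + n) (position v n) s → Cells (n * suc v) (m * rank (suc v)) s
    at-row-end s = Cells-cong s (trans (+-comm (n * v) n) (sym (*-suc n v)))
      (trans (cong (m * rank v +_) (*-comm (flag v) m)) (sym (*-distribˡ-+ m (rank v) (flag v))))

  compress-correct : ∀ {s} → Row 0 (assigned rv (const 0) s) → Run compress s (λ s′ →
    registers s′ 0 ≡ m × registers s′ 1 ≡ k × (∀ c → c < m * m → arrays s′ 0 c ≡ matrix H c))
  compress-correct row = assign-then
    (while Row (λ { ((n-eq , _) , v-eq , _) → cong₂ _∸_ n-eq v-eq }) copy-row-correct n≤N row
    then λ { ((_ , k-eq , m-eq , _) , _ , _ , _ , _ , written , _) →
      assign (m-eq , k-eq , written) })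

  finish-correct : ∀ {s} → Marking n s → Run finish s (λ s′ → Outputs s′ (kernelize I))
  finish-correct {s} ((n-eq , k-eq , b-eq) , A-eq , _ , _ , m-eq , flags , q-eq , p-eq)
    with m ≤? bound k
  ... | no large = if-then
    (λ guard → large (m∸n≡0⇒m≤n (trans (sym (cong₂ _∸_ m-eq b-eq)) guard)))
    (assign-then (assign record
      { order-output = refl ; parameter-output = refl ; graph-output = λ c () }))
  ... | yes small
    with t , s′ , run , (m-eq′ , k-eq′ , H-eq) , t≤ ← compress-correct
           ( (n-eq , k-eq , m-eq , flags) , refl , trans q-eq (sym (*-zeroʳ n))
           , trans p-eq (sym (*-zeroʳ m)) , ≤-reflexive (trans (*-zeroʳ m) (sym (*-zeroʳ n)))
           , (λ c c<0 → contradiction (subst (c <_) (*-zeroʳ m) c<0) λ ()) , λ c _ → A-eq c ) =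
    if-else {λ s → Outputs s record { order = m ; graph = H ; parameter = k }}
      (trans (cong₂ _∸_ m-eq b-eq) (m≤n⇒m∸n≡0 small))
      (t , s′ , run , outputs , t≤)
    where
    outputs : Outputs s′ record { order = m ; graph = H ; parameter = k }
    outputs = record
      { order-output = m-eq′ ; parameter-output = k-eq′ ; graph-output = H-eq }

  kernel-program-correct : Run kernel-program (input I) (λ s → Outputs s (kernelize I))
  kernel-program-correct =
    compute-bound-correct {b = 0} ((refl , refl , refl) , (λ c → refl) , refl , refl , refl , refl , refl)
    then λ { (sized , A-eq , m-eq , v-eq , nv-eq , q-eq , p-eq) →
      while Marking (λ { ((n-eq , _) , _ , v-eq , _) → cong₂ _∸_ n-eq v-eq }) mark-correct n≤N
        (sized , A-eq , v-eq , trans nv-eq (sym (*-zeroʳ n)) , m-eq , (λ c ()) , q-eq , p-eq)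
      then finish-correct }

instanceSize-kernelize : ∀ I → instanceSize (kernelize I) ≤ instanceSize I
instanceSize-kernelize I = +-mono-≤ (+-mono-≤ smaller (*-mono-≤ smaller smaller)) (parameter-kernelize I)
  where
  smaller : order (kernelize I) ≤ order I
  smaller = order-kernelize≤order I

-- The summand `N` pays for the output, which is never larger than the input.
steps-and-size : ∃[ c ] ∃[ d ] (∀ N → steps kernel-program N + N ≤ c * N ^ d + c)
steps-and-size =
  PolyBounded⇒≤ (PolyBounded-+ (steps-polynomial kernel-program) PolyBounded-id)

kernelize-polynomial : PolynomialTime kernelize
kernelize-polynomial = record
  { program     = kernel-program
  ; coefficient = proj₁ steps-and-size
  ; degree      = proj₁ (proj₂ steps-and-size)
  ; run         = λ I → let t , s , run , outputs , t≤ = Correct.kernel-program-correct I in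
      t , s , run , outputs
      , ≤-trans (+-mono-≤ t≤ (instanceSize-kernelize I)) (proj₂ (proj₂ steps-and-size) (instanceSize I))
  }

kernel-size : ℕ → ℕ
kernel-size k = bound k + bound k * bound k + k

theorem1 : ∃[ g ] ∃[ f ]
    ( IsKernel SavingLandmarks g f
    × (∀ I → order (f I) ≤ 8 * parameter I ^ 4) )
theorem1 = kernel-size , kernelize , kernel , order-kernelize
  where
  kernel : IsKernel SavingLandmarks kernel-size kernelize
  kernel = record
    { polynomialTime = kernelize-polynomial
    ; equivalent     = kernelize-equivalent
    ; bounded        = λ I → +-mono-≤
        (+-mono-≤ (order-kernelize I) (*-mono-≤ (order-kernelize I) (order-kernelize I)))
        (parameter-kernelize I)
    }
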